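{- With the addition $+$ and multiplication $\times$ defined digit-wise on infinite decimals as in the context, $(\mathbb{R},+,\times)$ is a field, where $\mathbb{R}$ denotes the set of infinite decimals $\{a_0.a_1a_2a_3\cdots\in\mathbb{Z}\times\mathbb{Z}_{10}^{\mathbb{N}}: a_k<9\text{ for infinitely many }k\}$.
   Context: Here $\mathbb{Z}_{10}=\{0,1,\ldots,9\}$ is the set of digits, $\mathbb{N}=\{1,2,3,\ldots\}$, and $\mathbb{R}$ denotes the concrete set of infinite decimals $a_0.a_1a_2a_3\cdots$ with $a_0\in\mathbb{Z}$, $a_k\in\mathbb{Z}_{10}$ for $k\ge1$, and $a_k<9$ for infinitely many $k$ (not a previously constructed real number system). Terminating decimals. An element $x=a_0.a_1a_2\cdots$ is terminating if there is an integer $m\ge0$ with $a_k=0$ for all $k>m$; it is then written $a_0.a_1\cdots a_m$ and identified with the rational number $a_0+\sum_{i=1}^m a_i10^{ -i}$ (so for negative $a_0$ the fractional part is still added, e.g. $(-3).4=-2.6$). Sums, products, negatives and comparisons of terminating decimals are the usual ones for rational numbers; $10^{ -m}$ is regarded as a terminating decimal. Digits and truncations. For $x=a_0.a_1a_2\cdots$ and an integer $k\ge0$, $\theta_k(x)=a_k$ is the $k$-th digit of $x$, and $x_k=a_0.a_1\cdots a_k$ is the truncation of $x$ up to the $k$-th digit, a terminating decimal. This notation is also applied to terminating decimals obtained as sums or products: $(u)_k$ is the truncation of $u$. Order and sign. Elements are compared lexicographically. An element is non-negative if $a_0\ge0$ and negative if $a_0<0$. Addition. Let $x=a_0.a_1a_2\cdots$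 and $y=b_0.b_1b_2\cdots$ be in $\mathbb{R}$. Case 1: if there is an integer $m\ge0$ with $a_k+b_k=9$ for all $k>m$, then $x+y=x_m+y_m+10^{ -m}$. Case 2: otherwise there are positive integers $k_1<k_2<\cdots$ with $a_{k_i}+b_{k_i}\ne9$ for all $i\in\mathbb{N}$, and $x+y$ is the infinite decimal determined by $(x+y)_{k_i-1}=(x_{k_i}+y_{k_i})_{k_i-1}$ for all $i\in\mathbb{N}$. Additive inverse. Let $x=a_0.a_1a_2\cdots\in\mathbb{R}$. If there is an integer $m\ge0$ with $a_k=0$ for all $k>m$, then $-x=-x_m$ (negative of a terminating decimal). Otherwise $-x=(-1-a_0).(9-a_1)(9-a_2)(9-a_3)\cdots$. Multiplication. Let $x,y\in\mathbb{R}$. (1) If $x,y$ are both non-negative, fix an integer $s\ge0$ with $x+y\le10^s$. Case 1: if there is an integer $m\ge0$ with $\theta_k(x_{k+s}y_{k+s})=9$ for all $k>m$, then $xy=(x_{m+s}y_{m+s})_m+10^{ -m}$. Case 2: otherwise there are positive integers $k_1<k_2<\cdots$ with $\theta_{k_i}(x_{k_i+s}y_{k_i+s})\ne9$ for all $i\in\mathbb{N}$, and $xy$ is the infinite decimal determined by $(xy)_{k_i-1}=(x_{k_i+s}y_{k_i+s})_{k_i-1}$ for all $i\in\mathbb{N}$. (2) If $x,y$ are both negative, $xy=(-x)(-y)$. (3) If exactly one of $x,y$ is negative, $xy=-(x(-y))$ when $y$ is the negative one, and symmetrically $xy=-((-x)y)$ when $x$ is the negative one. The product is also written $x\times y$.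 These prescriptions do not depend on the choices of $m$, $s$ or $(k_i)$ and yield elements of $\mathbb{R}$. -}

module Defs where

open import Level using (Level; 0ℓ; _⊔_)
open import Axiom.ExcludedMiddle using (ExcludedMiddle)
import Algebra.Definitions
import Algebra.Structures
open import Data.Nat as ℕ using (ℕ; zero; suc; pred)
import Data.Nat.Properties as ℕₚ
open import Data.Fin using (Fin; toℕ; fromℕ<; opposite)
import Data.Fin.Properties as Finₚ
open import Data.Integer as ℤ using (ℤ; +_; 0ℤ; 1ℤ; -1ℤ)
import Data.Integer.Properties as ℤₚ
import Data.Integer.DivMod as DivMod
open import Data.Integer.Tactic.RingSolver using (solve-∀)
open import Data.Rational.Unnormalised as ℚ using (ℚᵘ; mkℚᵘ; _≃_; *≡*)
import Data.Rational.Unnormalised.Properties as ℚₚ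
open import Data.Product using (Σ; ∃; _×_; _,_; proj₁; proj₂)
open import Data.Sum using (_⊎_; inj₁; inj₂)
open import Data.Empty using (⊥; ⊥-elim)
open import Relation.Nullary using (¬_; Dec; yes; no)
open import Relation.Binary.Core using (Rel)
open import Relation.Binary.Structures using (IsEquivalence)
open import Relation.Binary.PropositionalEquality
  using (_≡_; _≢_; refl; sym; trans; cong; cong₂; subst; subst₂)

record IsField {c ℓ : Level} {A : Set c} (_≈_ : Rel A ℓ)
               (_+_ _*_ : A → A → A) (-_ : A → A) (0# 1# : A) : Set (c ⊔ ℓ) where
  open Algebra.Structures _≈_ using (IsCommutativeRing)
  open Algebra.Definitions _≈_ using (Invertible)
  field
    isCommutativeRing : IsCommutativeRing _+_ _*_ -_ 0# 1#
    0≉1               : ¬ (0# ≈ 1#)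
    invertible        : ∀ x → ¬ (x ≈ 0#) → Invertible 1# _*_ x

-- a₀.a₁a₂a₃⋯ with  whole = a₀  and  frac i = a_{i+1}.
record ℝ : Set where
  field
    whole   : ℤ
    frac    : ℕ → Fin 10
    nonNine : ∀ n → ∃ λ i → n ℕ.≤ i × toℕ (frac i) ℕ.< 9

open ℝ public

θ : ℕ → ℝ → ℤ
θ zero    x = whole x
θ (suc i) x = + toℕ (frac x i)

-- Equality of elements of ℤ × ℤ₁₀^ℕ, digit by digit; the proof field nonNine
-- is disregarded.
record _≈_ (x y : ℝ) : Set where
  constructor digitwise
  field
    θ-≡ : ∀ k → θ k x ≡ θ k y

open _≈_ public

infix 4 _≈_ _<_ _≤_ _≙_

_<_ : ℝ → ℝ → Set
x < y = ∃ λ k → (∀ j → j ℕ.< k → θ j x ≡ θ j y) × θ k x ℤ.< θ k y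

_≤_ : ℝ → ℝ → Set
x ≤ y = x < y ⊎ x ≈ y

NonNegative Negative : ℝ → Set
NonNegative x = 0ℤ ℤ.≤ whole x
Negative    x = whole x ℤ.< 0ℤ

fromℤ : ℤ → ℝ
fromℤ n = record
  { whole   = n
  ; frac    = λ _ → Fin.zero
  ; nonNine = λ k → k , ℕₚ.≤-refl , ℕ.s≤s ℕ.z≤n
  }

0ℝ 1ℝ : ℝ
0ℝ = fromℤ 0ℤ
1ℝ = fromℤ 1ℤ

10^_ : ℕ → ℝ
10^ s = fromℤ (+ (10 ℕ.^ s))

infix 7 _/10^_

_/10^_ : ℤ → ℕ → ℚᵘ
n /10^ k = ℚ._/_ n (10 ℕ.^ k) {{ℕₚ.m^n≢0 10 k}}

10⁻ : ℕ → ℚᵘ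
10⁻ m = 1ℤ /10^ m

trunc : ℝ → ℕ → ℚᵘ
trunc x zero    = θ 0 x ℚ./ 1
trunc x (suc k) = trunc x k ℚ.+ θ (suc k) x /10^ suc k

TerminatesAt : ℝ → ℕ → Set
TerminatesAt x m = ∀ k → m ℕ.< k → θ k x ≡ 0ℤ

-- x is terminating and is identified with the rational number u.
_≙_ : ℝ → ℚᵘ → Set
x ≙ u = ∃ λ m → TerminatesAt x m × trunc x m ≃ u

-- For u (the value of) a terminating decimal:  θ_k(u) = d  and  (u)_k = q.
HasDigit : ℚᵘ → ℕ → ℤ → Set
HasDigit u k d = ∃ λ t → t ≙ u × θ k t ≡ d

HasTrunc : ℚᵘ → ℕ → ℚᵘ → Set
HasTrunc u k q = ∃ λ t → t ≙ u × trunc t k ≃ q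

-- k₁ < k₂ < ⋯ positive, with κ i = k_{i+1}.
Increasing : (ℕ → ℕ) → Set
Increasing κ = 0 ℕ.< κ 0 × (∀ i → κ i ℕ.< κ (suc i))

-- The sequence κ in case₂ rules out the hypothesis of case₁, so "otherwise"
-- needs no separate clause.
data IsSum (x y z : ℝ) : Set where
  case₁ : ∀ m →
          (∀ k → m ℕ.< k → θ k x ℤ.+ θ k y ≡ + 9) →
          z ≙ (trunc x m ℚ.+ trunc y m ℚ.+ 10⁻ m) →
          IsSum x y z
  case₂ : ∀ κ → Increasing κ →
          (∀ i → θ (κ i) x ℤ.+ θ (κ i) y ≢ + 9) →
          (∀ i → HasTrunc (trunc x (κ i) ℚ.+ trunc y (κ i)) (pred (κ i))
                          (trunc z (pred (κ i)))) →
          IsSum x y z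

data IsNegation (x z : ℝ) : Set where
  terminating    : ∀ m → TerminatesAt x m → z ≙ (ℚ.- trunc x m) → IsNegation x z
  nonTerminating : ¬ (∃ λ m → TerminatesAt x m) →
                   θ 0 z ≡ -1ℤ ℤ.- θ 0 x →
                   (∀ k → 0 ℕ.< k → θ k z ≡ + 9 ℤ.- θ k x) →
                   IsNegation x z

-- The module Lemmas serves only to show, for the module Arithmetic, that the
-- prescriptions yield elements of ℝ; there scaled x k = 10^k · x_k.

opaque
  pw : ℕ → ℤ
  pw k = + (10 ℕ.^ k)

  pw-def : ∀ k → pw k ≡ + (10 ℕ.^ k)
  pw-def k = refl

scaled : ℝ → ℕ → ℤ
scaled x zero    = θ 0 x
scaled x (suc k) = + 10 ℤ.* scaled x k ℤ.+ θ (suc k) x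

module Lemmas where

  open import Data.Integer using (_+_; _*_; _-_; -_)
    renaming (_≤_ to _≤ᶻ_; _<_ to _<ᶻ_)

  -- Linear arithmetic: i ≤ j is derived by writing j - i as a non-negative
  -- combination.

  0≤+ : ∀ {i j} → 0ℤ ≤ᶻ i → 0ℤ ≤ᶻ j → 0ℤ ≤ᶻ i + j
  0≤+ p q = ℤₚ.+-mono-≤ p q

  0≤* : ∀ {i j} → 0ℤ ≤ᶻ i → 0ℤ ≤ᶻ j → 0ℤ ≤ᶻ i * j
  0≤* {+ m} {+ n} _ _ = subst (0ℤ ≤ᶻ_) (ℤₚ.pos-* m n) (ℤ.+≤+ ℕ.z≤n)

  0≤pos : ∀ n → 0ℤ ≤ᶻ + n
  0≤pos n = ℤ.+≤+ ℕ.z≤n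

  slack : ∀ {i j} → i ≤ᶻ j → 0ℤ ≤ᶻ j - i
  slack = ℤₚ.i≤j⇒0≤j-i

  by-slack : ∀ {i j e} → 0ℤ ≤ᶻ e → j - i ≡ e → i ≤ᶻ j
  by-slack p eq = ℤₚ.0≤i-j⇒j≤i (subst (0ℤ ≤ᶻ_) (sym eq) p)

  *-monoˡ : ∀ {c i j} → 0ℤ ≤ᶻ c → i ≤ᶻ j → c * i ≤ᶻ c * j
  *-monoˡ {+ n} _ p = ℤₚ.*-monoˡ-≤-nonNeg (+ n) p

  impossible : ∀ {i} → i + 1ℤ ≤ᶻ i → ⊥
  impossible {i} p = go (subst (0ℤ ≤ᶻ_) (eq i) (slack p))
    where
    eq : ∀ i → i - (i + 1ℤ) ≡ -1ℤ
    eq = solve-∀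
    go : ¬ (0ℤ ≤ᶻ -1ℤ)
    go ()

  +1≤⇒< : ∀ {i j} → i + 1ℤ ≤ᶻ j → i <ᶻ j
  +1≤⇒< {i} p = ℤₚ.suc[i]≤j⇒i<j (subst (_≤ᶻ _) (ℤₚ.+-comm i 1ℤ) p)

  <⇒+1≤ : ∀ {i j} → i <ᶻ j → i + 1ℤ ≤ᶻ j
  <⇒+1≤ {i} p = subst (_≤ᶻ _) (ℤₚ.+-comm 1ℤ i) (ℤₚ.i<j⇒suc[i]≤j p)

  ≤∧≢⇒+1≤ : ∀ {i j} → i ≤ᶻ j → i ≢ j → i + 1ℤ ≤ᶻ j
  ≤∧≢⇒+1≤ p q = <⇒+1≤ (ℤₚ.≤∧≢⇒< p q)

  +1≤+1 : ∀ {i j} → i + 1ℤ ≤ᶻ j + 1ℤ → i ≤ᶻ j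
  +1≤+1 {i} {j} p = by-slack (slack p) (eq i j)
    where
    eq : ∀ i j → j - i ≡ (j + 1ℤ) - (i + 1ℤ)
    eq = solve-∀

  opaque
    unfolding pw

    0≤pw : ∀ d → 0ℤ ≤ᶻ pw d
    0≤pw d = 0≤pos _

    pw0-* : ∀ v → pw 0 * v ≡ v
    pw0-* v = ℤₚ.*-identityˡ v

    *-pw0 : ∀ v → v * pw 0 ≡ v
    *-pw0 v = ℤₚ.*-identityʳ v

    pw1 : pw 1 ≡ + 10
    pw1 = refl

    pw-suc : ∀ d → pw (suc d) ≡ + 10 * pw d
    pw-suc d = ℤₚ.pos-* 10 (10 ℕ.^ d)

    pw-+ : ∀ d e → pw (d ℕ.+ e) ≡ pw d * pw e
    pw-+ d e = trans (cong +_ (ℕₚ.^-distribˡ-+-* 10 d e)) (ℤₚ.pos-* (10 ℕ.^ d) (10 ℕ.^ e))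

    pw-pos : ∀ d → 1ℤ ≤ᶻ pw d
    pw-pos d = ℤ.+≤+ (ℕₚ.m^n>0 10 d)

    n<pw : ∀ n → + n + 1ℤ ≤ᶻ pw n
    n<pw zero    = ℤ.+≤+ (ℕ.s≤s ℕ.z≤n)
    n<pw (suc n) = by-slack
      (0≤+ (0≤* (0≤pos 9) (slack (pw-pos n))) (0≤+ (slack (n<pw n)) (0≤pos 8)))
      (trans (cong (_- (+ suc n + 1ℤ)) (pw-suc n)) (eq (+ n) (pw n)))
      where
      eq : ∀ n p → + 10 * p - ((1ℤ + n) + 1ℤ)
                 ≡ + 9 * (p - 1ℤ) + ((p - (n + 1ℤ)) + + 8)
      eq = solve-∀

    cancel-≤ : ∀ {i j} d → pw d * i ≤ᶻ pw d * j → i ≤ᶻ j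
    cancel-≤ {i} {j} d = ℤₚ.*-cancelˡ-≤-pos i j (pw d) {{positive (pw-pos d)}}
      where
      positive : ∀ {i} → 1ℤ ≤ᶻ i → ℤ.Positive i
      positive (ℤ.+≤+ (ℕ.s≤s _)) = _

    cancel-< : ∀ {i j} d → pw d * i + 1ℤ ≤ᶻ pw d * j → i + 1ℤ ≤ᶻ j
    cancel-< {i} {j} d p = <⇒+1≤ (ℤₚ.*-cancelˡ-<-nonNeg (pw d) (+1≤⇒< p))

  squeeze : ∀ {i j w} d → pw d * i ≤ᶻ w → w + 1ℤ ≤ᶻ pw d * j → i + 1ℤ ≤ᶻ j
  squeeze d p q = cancel-< d (ℤₚ.≤-trans (ℤₚ.+-monoˡ-≤ 1ℤ p) q)

  θ≥0 : ∀ x k → 0ℤ ≤ᶻ θ (suc k) x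
  θ≥0 x k = 0≤pos _

  θ≤9 : ∀ x k → θ (suc k) x ≤ᶻ + 9
  θ≤9 x k = ℤ.+≤+ (ℕ.s≤s⁻¹ (Finₚ.toℕ<n (frac x k)))

  scaled-lo : ∀ x d k → pw d * scaled x k ≤ᶻ scaled x (d ℕ.+ k)
  scaled-lo x zero    k = ℤₚ.≤-reflexive (pw0-* _)
  scaled-lo x (suc d) k = by-slack
    (0≤+ (0≤* (0≤pos 10) (slack (scaled-lo x d k))) (θ≥0 x (d ℕ.+ k)))
    (trans (cong (λ p → + 10 * S' + t - p * S) (pw-suc d)) (eq S' t (pw d) S))
    where
    S S' t : ℤ
    S  = scaled x k
    S' = scaled x (d ℕ.+ k)
    t  = θ (suc (d ℕ.+ k)) x
    eq : ∀ s' t p s → + 10 * s' + t - (+ 10 * p) * s ≡ + 10 * (s' - p * s) + t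
    eq = solve-∀

  scaled-hi : ∀ x d k → scaled x (d ℕ.+ k) + 1ℤ ≤ᶻ pw d * (scaled x k + 1ℤ)
  scaled-hi x zero    k = ℤₚ.≤-reflexive (sym (pw0-* _))
  scaled-hi x (suc d) k = by-slack
    (0≤+ (0≤* (0≤pos 10) (slack (scaled-hi x d k))) (slack (θ≤9 x (d ℕ.+ k))))
    (trans (cong (λ p → p * (S + 1ℤ) - (+ 10 * S' + t + 1ℤ)) (pw-suc d)) (eq S' t (pw d) S))
    where
    S S' t : ℤ
    S  = scaled x k
    S' = scaled x (d ℕ.+ k)
    t  = θ (suc (d ℕ.+ k)) x
    eq : ∀ s' t p s → (+ 10 * p) * (s + 1ℤ) - (+ 10 * s' + t + 1ℤ)
                    ≡ + 10 * (p * (s + 1ℤ) - (s' + 1ℤ)) + (+ 9 - t)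
    eq = solve-∀

  whole-lo : ∀ x k → pw k * whole x ≤ᶻ scaled x k
  whole-lo x k = subst (λ j → pw k * whole x ≤ᶻ scaled x j) (ℕₚ.+-identityʳ k) (scaled-lo x k 0)

  whole-hi : ∀ x k → scaled x k + 1ℤ ≤ᶻ pw k * (whole x + 1ℤ)
  whole-hi x k = subst (λ j → scaled x j + 1ℤ ≤ᶻ pw k * (whole x + 1ℤ))
                       (ℕₚ.+-identityʳ k) (scaled-hi x k 0)

  scaled≥0 : ∀ x → NonNegative x → ∀ k → 0ℤ ≤ᶻ scaled x k
  scaled≥0 x p k = ℤₚ.≤-trans (0≤* (0≤pw k) p) (whole-lo x k)

  -- Eventually the tail of x falls short of all nines by a fixed margin.
  gap : ∀ x k → ∃ λ d₀ → ∀ d → d₀ ℕ.≤ d →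
        scaled x (d ℕ.+ k) + + 10 ≤ᶻ pw d * (scaled x k + 1ℤ)
  gap x k with nonNine x k
  ... | i , k≤i , a<9 = suc (suc e) , λ d d₀≤d →
          subst (λ d → scaled x (d ℕ.+ k) + + 10 ≤ᶻ pw d * (S + 1ℤ))
                (ℕₚ.m∸n+n≡m d₀≤d) (go (d ℕ.∸ suc (suc e)))
    where
    e : ℕ
    e = i ℕ.∸ k
    e+k≡i : e ℕ.+ k ≡ i
    e+k≡i = ℕₚ.m∸n+n≡m k≤i
    S : ℤ
    S = scaled x k
    digit : θ (suc (e ℕ.+ k)) x ≤ᶻ + 8
    digit = subst (λ j → θ (suc j) x ≤ᶻ + 8) (sym e+k≡i) (ℤ.+≤+ (ℕ.s≤s⁻¹ a<9))
    base : scaled x (suc e ℕ.+ k) + + 2 ≤ᶻ pw (suc e) * (S + 1ℤ)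
    base = by-slack
      (0≤+ (0≤* (0≤pos 10) (slack (scaled-hi x e k))) (slack digit))
      (trans (cong (λ p → p * (S + 1ℤ) - (+ 10 * scaled x (e ℕ.+ k) + θ (suc (e ℕ.+ k)) x + + 2)) (pw-suc e))
             (eq (scaled x (e ℕ.+ k)) (θ (suc (e ℕ.+ k)) x) (pw e) S))
      where
      eq : ∀ s' t p s → (+ 10 * p) * (s + 1ℤ) - (+ 10 * s' + t + + 2)
                      ≡ + 10 * (p * (s + 1ℤ) - (s' + 1ℤ)) + (+ 8 - t)
      eq = solve-∀
    step : ∀ d c → scaled x (d ℕ.+ k) + + suc (suc c) ≤ᶻ pw d * (S + 1ℤ) →
           scaled x (suc d ℕ.+ k) + + 10 ≤ᶻ pw (suc d) * (S + 1ℤ)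
    step d c h = by-slack
      (0≤+ (0≤+ (0≤* (0≤pos 10) (slack h)) (slack (θ≤9 x (d ℕ.+ k))))
           (0≤+ (0≤pos 1) (0≤* (0≤pos 10) (0≤pos c))))
      (trans (cong (λ p → p * (S + 1ℤ) - (+ 10 * scaled x (d ℕ.+ k) + θ (suc (d ℕ.+ k)) x + + 10)) (pw-suc d))
             (eq (scaled x (d ℕ.+ k)) (θ (suc (d ℕ.+ k)) x) (pw d) S (+ c)))
      where
      eq : ∀ s' t p s c → (+ 10 * p) * (s + 1ℤ) - (+ 10 * s' + t + + 10)
         ≡ (+ 10 * (p * (s + 1ℤ) - (s' + (+ 2 + c))) + (+ 9 - t)) + (+ 1 + + 10 * c)
      eq = solve-∀
    go : ∀ f → scaled x ((f ℕ.+ suc (suc e)) ℕ.+ k) + + 10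
               ≤ᶻ pw (f ℕ.+ suc (suc e)) * (S + 1ℤ)
    go zero    = step (suc e) 0 base
    go (suc f) = step (f ℕ.+ suc (suc e)) 8 (go f)

  private
    /-≃ : ∀ n d m e .{{_ : ℕ.NonZero d}} .{{_ : ℕ.NonZero e}} →
          n * + e ≡ m * + d → n ℚ./ d ≃ m ℚ./ e
    /-≃ n (suc d) m (suc e) eq = *≡* eq

    /-≃⁻¹ : ∀ n d m e .{{_ : ℕ.NonZero d}} .{{_ : ℕ.NonZero e}} →
            n ℚ./ d ≃ m ℚ./ e → n * + e ≡ m * + d
    /-≃⁻¹ n (suc d) m (suc e) (*≡* eq) = eq

    /-+ : ∀ n m d .{{_ : ℕ.NonZero d}} → (n ℚ./ d) ℚ.+ (m ℚ./ d) ≃ (n + m) ℚ./ d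
    /-+ n m (suc d) = *≡* (eq n m (+ suc d))
      where
      eq : ∀ n m d → (n * d + m * d) * d ≡ (n + m) * (d * d)
      eq = solve-∀

    /-* : ∀ n d m e .{{_ : ℕ.NonZero d}} .{{_ : ℕ.NonZero e}} →
          (n ℚ./ d) ℚ.* (m ℚ./ e) ≃ ℚ._/_ (n * m) (d ℕ.* e) {{ℕₚ.m*n≢0 d e}}
    /-* n (suc d) m (suc e) = *≡* refl

    /-neg : ∀ n d .{{_ : ℕ.NonZero d}} → ℚ.- (n ℚ./ d) ≃ (- n) ℚ./ d
    /-neg n (suc d) = *≡* refl

  10^≢0 : ∀ k → ℕ.NonZero (10 ℕ.^ k)
  10^≢0 k = ℕₚ.m^n≢0 10 k

  opaque
    unfolding pw

    /10^-≃ : ∀ n k m l → n * pw l ≡ m * pw k → n /10^ k ≃ m /10^ l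
    /10^-≃ n k m l = /-≃ n (10 ℕ.^ k) m (10 ℕ.^ l) {{10^≢0 k}} {{10^≢0 l}}

    /10^-≃⁻¹ : ∀ n k m l → n /10^ k ≃ m /10^ l → n * pw l ≡ m * pw k
    /10^-≃⁻¹ n k m l = /-≃⁻¹ n (10 ℕ.^ k) m (10 ℕ.^ l) {{10^≢0 k}} {{10^≢0 l}}

  /10^-+ : ∀ n m k → (n /10^ k) ℚ.+ (m /10^ k) ≃ (n + m) /10^ k
  /10^-+ n m k = /-+ n m (10 ℕ.^ k) {{10^≢0 k}}

  /10^-* : ∀ n k m l → (n /10^ k) ℚ.* (m /10^ l) ≃ (n * m) /10^ (k ℕ.+ l)
  /10^-* n k m l = ℚₚ.≃-trans
    (/-* n (10 ℕ.^ k) m (10 ℕ.^ l) {{10^≢0 k}} {{10^≢0 l}})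
    (/-≃ (n * m) (10 ℕ.^ k ℕ.* 10 ℕ.^ l) (n * m) (10 ℕ.^ (k ℕ.+ l))
         {{ℕₚ.m*n≢0 (10 ℕ.^ k) (10 ℕ.^ l) {{10^≢0 k}} {{10^≢0 l}}}} {{10^≢0 (k ℕ.+ l)}}
         (cong (λ j → n * m * + j) (ℕₚ.^-distribˡ-+-* 10 k l)))

  /10^-neg : ∀ n k → ℚ.- (n /10^ k) ≃ (- n) /10^ k
  /10^-neg n k = /-neg n (10 ℕ.^ k) {{10^≢0 k}}

  trunc-scaled : ∀ x k → trunc x k ≃ scaled x k /10^ k
  trunc-scaled x zero    = ℚₚ.≃-refl
  trunc-scaled x (suc k) = ℚₚ.≃-trans
    (ℚₚ.+-congˡ (θ (suc k) x /10^ suc k)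
      (ℚₚ.≃-trans (trunc-scaled x k)
        (/10^-≃ S k (+ 10 * S) (suc k) (trans (cong (S *_) (pw-suc k)) (eq S (pw k))))))
    (/10^-+ (+ 10 * S) (θ (suc k) x) (suc k))
    where
    S : ℤ
    S = scaled x k
    eq : ∀ s p → s * (+ 10 * p) ≡ (+ 10 * s) * p
    eq = solve-∀

  opaque
    unfolding pw

    /10^-injective : ∀ {n m} k → n /10^ k ≃ m /10^ k → n ≡ m
    /10^-injective {n} {m} k eq = ℤₚ.*-cancelʳ-≡ n m (pw k) {{10^≢0 k}} (/10^-≃⁻¹ n k m k eq)

  trunc-injective : ∀ x y k → trunc x k ≃ trunc y k → scaled x k ≡ scaled y k
  trunc-injective x y k eq = /10^-injective k
    (ℚₚ.≃-trans (ℚₚ.≃-sym (trunc-scaled x k)) (ℚₚ.≃-trans eq (trunc-scaled y k)))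

  trunc-cong : ∀ x y k → scaled x k ≡ scaled y k → trunc x k ≃ trunc y k
  trunc-cong x y k eq = ℚₚ.≃-trans (trunc-scaled x k)
    (ℚₚ.≃-trans (ℚₚ.≃-reflexive (cong (_/10^ k) eq)) (ℚₚ.≃-sym (trunc-scaled y k)))

  trunc-+ : ∀ x y k → trunc x k ℚ.+ trunc y k ≃ (scaled x k + scaled y k) /10^ k
  trunc-+ x y k = ℚₚ.≃-trans (ℚₚ.+-cong (trunc-scaled x k) (trunc-scaled y k))
                             (/10^-+ (scaled x k) (scaled y k) k)

  trunc-* : ∀ x y k → trunc x k ℚ.* trunc y k ≃ (scaled x k * scaled y k) /10^ (k ℕ.+ k)
  trunc-* x y k = ℚₚ.≃-trans (ℚₚ.*-cong (trunc-scaled x k) (trunc-scaled y k))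
                             (/10^-* (scaled x k) k (scaled y k) k)

  trunc-neg : ∀ x k → ℚ.- trunc x k ≃ (- scaled x k) /10^ k
  trunc-neg x k = ℚₚ.≃-trans (ℚₚ.-‿cong (trunc-scaled x k)) (/10^-neg (scaled x k) k)

  ≙-resp : ∀ {x u v} → u ≃ v → x ≙ u → x ≙ v
  ≙-resp eq (m , t , p) = m , t , ℚₚ.≃-trans p eq

  ≙-whole-< : ∀ t N m B → t ≙ N /10^ m → N + 1ℤ ≤ᶻ pw m * B → whole t + 1ℤ ≤ᶻ B
  ≙-whole-< t N m B (l , _ , eq) N<B = cancel-< (l ℕ.+ m) (by-slack
    (0≤+ (0≤* (0≤pw l) (slack N<B)) (0≤+ (0≤* (0≤pw m) (slack (whole-lo t l))) (slack (pw-pos l))))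
    (trans (cong (λ p → p * B - (p * whole t + 1ℤ)) (pw-+ l m))
      (trans (eq₁ (pw l) (pw m) B (whole t) (scaled t l) N)
        (trans (cong (λ e → pw l * (pw m * B - (N + 1ℤ)) + (pw m * (scaled t l - pw l * whole t) + (pw l - 1ℤ)) + e)
                 (trans (cong (λ e → N * pw l - e) S≡) (ℤₚ.+-inverseʳ (N * pw l))))
          (ℤₚ.+-identityʳ _)))))
    where
    S≡ : scaled t l * pw m ≡ N * pw l
    S≡ = /10^-≃⁻¹ (scaled t l) l N m (ℚₚ.≃-trans (ℚₚ.≃-sym (trunc-scaled t l)) eq)
    eq₁ : ∀ p q b w s n → (p * q) * b - ((p * q) * w + 1ℤ)
        ≡ p * (q * b - (n + 1ℤ)) + (q * (s - p * w) + (p - 1ℤ)) + (n * p - s * q)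
    eq₁ = solve-∀

  ≙-whole-≥0 : ∀ t N m → t ≙ N /10^ m → 0ℤ ≤ᶻ N → NonNegative t
  ≙-whole-≥0 t N m (l , _ , eq) 0≤N = +1≤+1 (cancel-< l (ℤₚ.≤-trans
      (subst (_≤ᶻ scaled t l + 1ℤ) (cong (_+ 1ℤ) (sym (ℤₚ.*-zeroʳ (pw l)))) (ℤₚ.+-monoˡ-≤ 1ℤ 0≤S))
      (whole-hi t l)))
    where
    S≡ : scaled t l * pw m ≡ N * pw l
    S≡ = /10^-≃⁻¹ (scaled t l) l N m (ℚₚ.≃-trans (ℚₚ.≃-sym (trunc-scaled t l)) eq)
    0≤S : 0ℤ ≤ᶻ scaled t l
    0≤S = cancel-≤ m (subst₂ _≤ᶻ_ (sym (ℤₚ.*-zeroʳ (pw m)))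
                        (trans (sym S≡) (ℤₚ.*-comm (scaled t l) (pw m)))
                        (0≤* 0≤N (0≤pw l)))

  fromScaled : (Z : ℕ → ℤ) →
               (∀ k → + 10 * Z k ≤ᶻ Z (suc k)) →
               (∀ k → Z (suc k) ≤ᶻ + 10 * Z k + + 9) →
               (∀ n → ∃ λ k → n ℕ.≤ k × Z (suc k) + 1ℤ ≤ᶻ + 10 * Z k + + 9) →
               ∃ λ x → ∀ k → scaled x k ≡ Z k
  fromScaled Z lo hi nn = x , scaled≡
    where
    e : ℕ → ℤ
    e k = Z (suc k) - + 10 * Z k
    0≤e : ∀ k → 0ℤ ≤ᶻ e k
    0≤e k = slack (lo k)
    +∣e∣≡e : ∀ k → + ℤ.∣ e k ∣ ≡ e k
    +∣e∣≡e k = ℤₚ.0≤i⇒+∣i∣≡i (0≤e k)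
    bound : ∀ {z z' c} → z' ≤ᶻ + 10 * z + c → z' - + 10 * z ≤ᶻ c
    bound {z} {z'} {c} p = by-slack (slack p) (eq z z' c)
      where
      eq : ∀ z z' c → c - (z' - + 10 * z) ≡ + 10 * z + c - z'
      eq = solve-∀
    ∣e∣<10 : ∀ k → ℤ.∣ e k ∣ ℕ.< 10
    ∣e∣<10 k = ℕ.s≤s (ℤₚ.drop‿+≤+ (subst (_≤ᶻ + 9) (sym (+∣e∣≡e k)) (bound (hi k))))
    ∣e∣<9 : ∀ k → Z (suc k) + 1ℤ ≤ᶻ + 10 * Z k + + 9 → ℤ.∣ e k ∣ ℕ.< 9
    ∣e∣<9 k p = ℕ.s≤s (ℤₚ.drop‿+≤+ (subst (_≤ᶻ + 8) (sym (+∣e∣≡e k))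
                  (by-slack (slack p) (eq (Z k) (Z (suc k))))))
      where
      eq : ∀ z z' → + 8 - (z' - + 10 * z) ≡ + 10 * z + + 9 - (z' + 1ℤ)
      eq = solve-∀
    x : ℝ
    x = record
      { whole   = Z 0
      ; frac    = λ k → fromℕ< (∣e∣<10 k)
      ; nonNine = λ n → let k , n≤k , p = nn n in
          k , n≤k , subst (ℕ._< 9) (sym (Finₚ.toℕ-fromℕ< (∣e∣<10 k))) (∣e∣<9 k p)
      }
    scaled≡ : ∀ k → scaled x k ≡ Z k
    scaled≡ zero    = refl
    scaled≡ (suc k) = trans
      (cong₂ (λ s d → + 10 * s + d) (scaled≡ k)
             (trans (cong +_ (Finₚ.toℕ-fromℕ< (∣e∣<10 k))) (+∣e∣≡e k)))
      (eq (Z k) (Z (suc k)))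
      where
      eq : ∀ z z' → + 10 * z + (z' - + 10 * z) ≡ z'
      eq = solve-∀

  absorbed : ∀ i j → i + j ≡ i → j ≡ 0ℤ
  absorbed i j p = trans (eq i j) (trans (cong (_- i) p) (ℤₚ.+-inverseʳ i))
    where
    eq : ∀ i j → j ≡ (i + j) - i
    eq = solve-∀

  floor10 : ℤ → ℕ → ℤ
  floor10 n e = DivMod._/ℕ_ n (10 ℕ.^ e) {{10^≢0 e}}

  opaque
    unfolding pw

    floor10-lo : ∀ n e → pw e * floor10 n e ≤ᶻ n
    floor10-lo n e = subst (_≤ᶻ n) (ℤₚ.*-comm (floor10 n e) (pw e))
                       (DivMod.[n/ℕd]*d≤n n (10 ℕ.^ e) {{10^≢0 e}})

    floor10-hi : ∀ n e → n + 1ℤ ≤ᶻ pw e * (floor10 n e + 1ℤ)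
    floor10-hi n e = subst (n + 1ℤ ≤ᶻ_) (eq (floor10 n e) (pw e))
                       (<⇒+1≤ (DivMod.n<s[n/ℕd]*d n (10 ℕ.^ e) {{10^≢0 e}}))
      where
      eq : ∀ q p → (1ℤ + q) * p ≡ p * (q + 1ℤ)
      eq = solve-∀

  floor10-0 : ∀ n → floor10 n 0 ≡ n
  floor10-0 n = ℤₚ.≤-antisym
    (subst (_≤ᶻ n) (pw0-* _) (floor10-lo n 0))
    (+1≤+1 (subst (n + 1ℤ ≤ᶻ_) (pw0-* _) (floor10-hi n 0)))

  floor10-suc-lo : ∀ n e → + 10 * floor10 n (suc e) ≤ᶻ floor10 n e
  floor10-suc-lo n e = +1≤+1 (squeeze e
    (subst (_≤ᶻ n) (trans (cong (_* q) (pw-suc e)) (eq (pw e) q)) (floor10-lo n (suc e)))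
    (floor10-hi n e))
    where
    q : ℤ
    q = floor10 n (suc e)
    eq : ∀ p q → (+ 10 * p) * q ≡ p * (+ 10 * q)
    eq = solve-∀

  floor10-suc-hi : ∀ n e → floor10 n e ≤ᶻ + 10 * floor10 n (suc e) + + 9
  floor10-suc-hi n e = +1≤+1 (squeeze e (floor10-lo n e)
    (subst (n + 1ℤ ≤ᶻ_) (trans (cong (_* (q + 1ℤ)) (pw-suc e)) (eq (pw e) q))
      (floor10-hi n (suc e))))
    where
    q : ℤ
    q = floor10 n (suc e)
    eq : ∀ p q → (+ 10 * p) * (q + 1ℤ) ≡ p * (+ 10 * q + + 9 + 1ℤ)
    eq = solve-∀

  terminal : ∀ N m → ∃ λ t → TerminatesAt t m × scaled t m ≡ N
  terminal N m = t , stops , trans (scaled≡ m) Zm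
    where
    Z : ℕ → ℤ
    Z j = floor10 (N * pw (j ℕ.∸ m)) (m ℕ.∸ j)
    Zm : Z m ≡ N
    Zm rewrite ℕₚ.n∸n≡0 m = trans (floor10-0 (N * pw 0)) (*-pw0 N)
    late : ∀ j → m ℕ.≤ j → Z (suc j) ≡ + 10 * Z j
    late j m≤j rewrite ℕₚ.m≤n⇒m∸n≡0 m≤j | ℕₚ.m≤n⇒m∸n≡0 (ℕₚ.m≤n⇒m≤1+n m≤j)
                     | ℕₚ.+-∸-assoc 1 m≤j =
      trans (floor10-0 _)
        (trans (trans (cong (N *_) (pw-suc (j ℕ.∸ m))) (eq N (pw (j ℕ.∸ m))))
               (cong (+ 10 *_) (sym (floor10-0 _))))
      where
      eq : ∀ n p → n * (+ 10 * p) ≡ + 10 * (n * p)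
      eq = solve-∀
    early : ∀ j → j ℕ.< m →
            (+ 10 * Z j ≤ᶻ Z (suc j)) × (Z (suc j) ≤ᶻ + 10 * Z j + + 9)
    early j j<m rewrite ℕₚ.m≤n⇒m∸n≡0 j<m | ℕₚ.m≤n⇒m∸n≡0 (ℕₚ.<⇒≤ j<m)
                      | ℕₚ.+-∸-assoc 1 j<m =
      floor10-suc-lo (N * pw 0) (m ℕ.∸ suc j) , floor10-suc-hi (N * pw 0) (m ℕ.∸ suc j)
    lo : ∀ k → + 10 * Z k ≤ᶻ Z (suc k)
    lo k with k ℕ.<? m
    ... | yes k<m = proj₁ (early k k<m)
    ... | no  k≮m = ℤₚ.≤-reflexive (sym (late k (ℕₚ.≮⇒≥ k≮m)))
    hi : ∀ k → Z (suc k) ≤ᶻ + 10 * Z k + + 9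
    hi k with k ℕ.<? m
    ... | yes k<m = proj₂ (early k k<m)
    ... | no  k≮m = by-slack (0≤pos 9)
      (trans (cong (λ z → + 10 * Z k + + 9 - z) (late k (ℕₚ.≮⇒≥ k≮m))) (eq (Z k)))
      where
      eq : ∀ z → + 10 * z + + 9 - + 10 * z ≡ + 9
      eq = solve-∀
    nn : ∀ n → ∃ λ k → n ℕ.≤ k × Z (suc k) + 1ℤ ≤ᶻ + 10 * Z k + + 9
    nn n = k , ℕₚ.m≤m⊔n n m , by-slack (0≤pos 8)
      (trans (cong (λ z → + 10 * Z k + + 9 - (z + 1ℤ)) (late k (ℕₚ.m≤n⊔m n m))) (eq (Z k)))
      where
      k : ℕ
      k = n ℕ.⊔ m
      eq : ∀ z → + 10 * z + + 9 - (+ 10 * z + 1ℤ) ≡ + 8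
      eq = solve-∀
    result : ∃ λ x → ∀ k → scaled x k ≡ Z k
    result = fromScaled Z lo hi nn
    t : ℝ
    t = proj₁ result
    scaled≡ : ∀ k → scaled t k ≡ Z k
    scaled≡ = proj₂ result
    stops : TerminatesAt t m
    stops (suc k) (ℕ.s≤s m≤k) = absorbed (+ 10 * scaled t k) (θ (suc k) t)
      (trans (scaled≡ (suc k))
        (trans (late k m≤k)
          (cong (+ 10 *_) (sym (scaled≡ k)))))

  opaque
    terminal-≙ : ∀ N m → ∃ λ t → t ≙ N /10^ m × scaled t m ≡ N
    terminal-≙ N m = let t , stops , eq = terminal N m in
      t , (m , stops , ℚₚ.≃-trans (trunc-scaled t m) (ℚₚ.≃-reflexive (cong (_/10^ m) eq))) , eq

  NotNine : ℤ → Set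
  NotNine w = ∀ q → w ≢ + 10 * q + + 9

  notNine : ∀ s r → 0ℤ ≤ᶻ r → r ≤ᶻ + 18 → r ≢ + 9 → NotNine (+ 10 * s + r)
  notNine s r 0≤r r≤18 r≢9 q eq = go (q - s) r≡
    where
    r≡ : r ≡ + 10 * (q - s) + + 9
    r≡ = trans (eq₁ s r) (trans (cong (_- + 10 * s) eq) (eq₂ q s))
      where
      eq₁ : ∀ s r → r ≡ (+ 10 * s + r) - + 10 * s
      eq₁ = solve-∀
      eq₂ : ∀ q s → (+ 10 * q + + 9) - + 10 * s ≡ + 10 * (q - s) + + 9
      eq₂ = solve-∀
    go : ∀ c → r ≡ + 10 * c + + 9 → ⊥
    go (+ zero)      p = r≢9 p
    go (+ suc c)     p = impossible {+ 18} (ℤₚ.≤-trans (by-slack (0≤* (0≤pos 10) (0≤pos c)) (e (+ c)))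
                                              (subst (_≤ᶻ + 18) p r≤18))
      where
      e : ∀ c → + 10 * (1ℤ + c) + + 9 - + 19 ≡ + 10 * c
      e = solve-∀
    go (ℤ.-[1+ c ]) p = impossible { -1ℤ} (ℤₚ.≤-trans (subst (0ℤ ≤ᶻ_) p 0≤r)
                          (by-slack (0≤* (0≤pos 10) (0≤pos c)) (e (+ c))))
      where
      e : ∀ c → -1ℤ - (+ 10 * (- (1ℤ + c)) + + 9) ≡ + 10 * c
      e = solve-∀

  product-lower : ∀ {a b a' b' d c w} → 0ℤ ≤ᶻ d → 0ℤ ≤ᶻ a → 0ℤ ≤ᶻ b' →
                  d * a ≤ᶻ a' → d * b ≤ᶻ b' → c * w ≤ᶻ a * b →
                  (c * d) * (d * w) ≤ᶻ a' * b'
  product-lower {a} {b} {a'} {b'} {d} {c} {w} 0≤d 0≤a 0≤b' a-lo b-lo w-lo = by-slack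
    (0≤+ (0≤+ (0≤* (0≤* 0≤d 0≤d) (slack w-lo)) (0≤* (slack a-lo) 0≤b'))
         (0≤* (0≤* 0≤d 0≤a) (slack b-lo)))
    (eq a b a' b' d c w)
    where
    eq : ∀ a b a' b' d c w → a' * b' - (c * d) * (d * w)
       ≡ ((d * d) * (a * b - c * w) + (a' - d * a) * b') + (d * a) * (b' - d * b)
    eq = solve-∀

  product-upper : ∀ {a b a' b' d c w e} → 1ℤ ≤ᶻ d → 0ℤ ≤ᶻ a → 0ℤ ≤ᶻ b' →
                  d * a ≤ᶻ a' → a' + e ≤ᶻ d * (a + 1ℤ) → b' + e ≤ᶻ d * (b + 1ℤ) →
                  a' + b' ≤ᶻ c * d → a * b + 1ℤ ≤ᶻ c * (w + 1ℤ) →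
                  a' * b' + 1ℤ ≤ᶻ (c * d) * (d * (w + + 2) - e)
  product-upper {a} {b} {a'} {b'} {d} {c} {w} {e} 1≤d 0≤a 0≤b' a-lo a-hi b-hi sum w-hi =
    ℤₚ.≤-trans (ℤₚ.+-monoˡ-≤ 1ℤ first) second
    where
    0≤d : 0ℤ ≤ᶻ d
    0≤d = ℤₚ.≤-trans (0≤pos 1) 1≤d
    0≤d-e : 0ℤ ≤ᶻ d - e
    0≤d-e = subst (0ℤ ≤ᶻ_) (eq d e a a') (0≤+ (slack a-lo) (slack a-hi))
      where
      eq : ∀ d e a a' → (a' - d * a) + (d * (a + 1ℤ) - (a' + e)) ≡ d - e
      eq = solve-∀
    first : a' * b' ≤ᶻ (d * d) * (a * b) + (d - e) * (c * d)
    first = by-slack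
      (0≤+ (0≤+ (0≤* 0≤d-e (slack sum)) (0≤* 0≤d-e (slack a-lo)))
           (0≤+ (0≤* (slack a-hi) 0≤b') (0≤* (0≤* 0≤d 0≤a) (slack b-hi))))
      (eq a b a' b' d e (c * d))
      where
      eq : ∀ a b a' b' d e q → (d * d) * (a * b) + (d - e) * q - a' * b'
         ≡ ((d - e) * (q - (a' + b')) + (d - e) * (a' - d * a))
           + ((d * (a + 1ℤ) - (a' + e)) * b' + (d * a) * (d * (b + 1ℤ) - (b' + e)))
      eq = solve-∀
    second : (d * d) * (a * b) + (d - e) * (c * d) + 1ℤ ≤ᶻ (c * d) * (d * (w + + 2) - e)
    second = by-slack
      (0≤+ (0≤* (0≤* 0≤d 0≤d) (slack w-hi))
           (0≤+ (0≤* (slack 1≤d) 0≤d) (slack 1≤d)))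
      (eq (a * b) d c w e)
      where
      eq : ∀ p d c w e → (c * d) * (d * (w + + 2) - e) - ((d * d) * p + (d - e) * (c * d) + 1ℤ)
         ≡ (d * d) * (c * (w + 1ℤ) - (p + 1ℤ)) + ((d - 1ℤ) * d + (d - 1ℤ))
      eq = solve-∀

  -- W k is 10^k times the k-th approximation of a sum or product, each
  -- approximation falling short of the limit by less than two units.
  record Carrying (W : ℕ → ℤ) : Set where
    field
      lo   : ∀ d k → pw d * W k ≤ᶻ W (d ℕ.+ k)
      hi   : ∀ d k → W (d ℕ.+ k) + 1ℤ ≤ᶻ pw d * (W k + + 2)
      gap₂ : ∀ k → ∃ λ d → W (d ℕ.+ k) + + 3 ≤ᶻ pw d * (W k + + 2)
      good : ∀ m → ∃ λ k → m ℕ.< k × NotNine (W k)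

  last-lo : ∀ t k → + 10 * scaled t k ≤ᶻ scaled t (suc k)
  last-lo t k = by-slack (θ≥0 t k) (eq (scaled t k) (θ (suc k) t))
    where
    eq : ∀ s d → + 10 * s + d - + 10 * s ≡ d
    eq = solve-∀

  last-hi : ∀ t k → scaled t (suc k) ≤ᶻ + 10 * scaled t k + + 9
  last-hi t k = ℤₚ.+-monoʳ-≤ (+ 10 * scaled t k) (θ≤9 t k)

  module _ (em : ExcludedMiddle 0ℓ) {W : ℕ → ℤ} (carrying : Carrying W) where
    open Carrying carrying

    private
      Settled : ℕ → ℤ → Set
      Settled j Z = ∃ λ K → ∀ e → K ℕ.≤ e →
        (pw e * Z ≤ᶻ W (e ℕ.+ j)) × (W (e ℕ.+ j) + 1ℤ ≤ᶻ pw e * (Z + 1ℤ))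

      settled-≤ : ∀ {j Z Z'} → Settled j Z → Settled j Z' → Z ≤ᶻ Z'
      settled-≤ (K , p) (K' , p') = +1≤+1 (squeeze (K ℕ.⊔ K')
        (proj₁ (p _ (ℕₚ.m≤m⊔n K K'))) (proj₂ (p' _ (ℕₚ.m≤n⊔m K K'))))

      settled-≡ : ∀ {j Z Z'} → Settled j Z → Settled j Z' → Z ≡ Z'
      settled-≡ p q = ℤₚ.≤-antisym (settled-≤ p q) (settled-≤ q p)

      settle : ∀ e j T → NotNine (W (suc e ℕ.+ j)) →
               pw (suc e) * T ≤ᶻ W (suc e ℕ.+ j) →
               W (suc e ℕ.+ j) + 1ℤ ≤ᶻ pw (suc e) * (T + 1ℤ) →
               Settled j T
      settle e j T nn p q = suc e , λ e' se≤e' →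
        subst (λ e' → (pw e' * T ≤ᶻ W (e' ℕ.+ j)) × (W (e' ℕ.+ j) + 1ℤ ≤ᶻ pw e' * (T + 1ℤ)))
              (ℕₚ.m∸n+n≡m se≤e') (later (e' ℕ.∸ suc e))
        where
        w : ℤ
        w = W (suc e ℕ.+ j)
        w≢ : w + 1ℤ ≢ pw (suc e) * (T + 1ℤ)
        w≢ eq = nn (pw e * (T + 1ℤ) - 1ℤ)
          (trans (e₁ w) (trans (cong (_- 1ℤ) eq)
            (trans (cong (λ p → p * (T + 1ℤ) - 1ℤ) (pw-suc e)) (e₂ (pw e) T))))
          where
          e₁ : ∀ w → w ≡ w + 1ℤ - 1ℤ
          e₁ = solve-∀
          e₂ : ∀ p t → (+ 10 * p) * (t + 1ℤ) - 1ℤ ≡ + 10 * (p * (t + 1ℤ) - 1ℤ) + + 9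
          e₂ = solve-∀
        q₂ : w + + 2 ≤ᶻ pw (suc e) * (T + 1ℤ)
        q₂ = subst (_≤ᶻ pw (suc e) * (T + 1ℤ)) (ℤₚ.+-assoc w 1ℤ 1ℤ) (≤∧≢⇒+1≤ q w≢)
        later : ∀ d → (pw (d ℕ.+ suc e) * T ≤ᶻ W ((d ℕ.+ suc e) ℕ.+ j)) ×
                      (W ((d ℕ.+ suc e) ℕ.+ j) + 1ℤ ≤ᶻ pw (d ℕ.+ suc e) * (T + 1ℤ))
        later d =
          subst₂ _≤ᶻ_ (assoc T) W≡ (ℤₚ.≤-trans (*-monoˡ (0≤pw d) p) (lo d (suc e ℕ.+ j))) ,
          subst₂ _≤ᶻ_ (cong (_+ 1ℤ) W≡) (assoc (T + 1ℤ))
            (ℤₚ.≤-trans (hi d (suc e ℕ.+ j)) (*-monoˡ (0≤pw d) q₂))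
          where
          assoc : ∀ v → pw d * (pw (suc e) * v) ≡ pw (d ℕ.+ suc e) * v
          assoc v = trans (sym (ℤₚ.*-assoc (pw d) (pw (suc e)) v))
                          (cong (_* v) (sym (pw-+ d (suc e))))
          W≡ : W (d ℕ.+ (suc e ℕ.+ j)) ≡ W ((d ℕ.+ suc e) ℕ.+ j)
          W≡ = cong W (sym (ℕₚ.+-assoc d (suc e) j))

      value : ∀ j → ∃ λ Z → Settled j Z
      value j with good j
      ... | k , j<k , nn with ℕₚ.m∸n+n≡m j<k
      ... | eq = T , settle e j T nn' (floor10-lo w (suc e)) (floor10-hi w (suc e))
        where
        e : ℕ
        e = k ℕ.∸ suc j
        w T : ℤ
        w = W (suc e ℕ.+ j)
        T = floor10 w (suc e)
        nn' : NotNine w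
        nn' = subst (λ k → NotNine (W k)) (trans (sym eq) (ℕₚ.+-suc e j)) nn

      Z : ℕ → ℤ
      Z j = proj₁ (value j)

      settled : ∀ j → Settled j (Z j)
      settled j = proj₂ (value j)

      pw-assoc : ∀ e z → pw (suc e) * z ≡ pw e * (+ 10 * z)
      pw-assoc e z = trans (cong (_* z) (pw-suc e)) (eq (pw e) z)
        where
        eq : ∀ p z → (+ 10 * p) * z ≡ p * (+ 10 * z)
        eq = solve-∀

      Z-step : ∀ j → (+ 10 * Z j ≤ᶻ Z (suc j)) × (Z (suc j) ≤ᶻ + 10 * Z j + + 9)
      Z-step j =
        +1≤+1 (squeeze e (subst₂ _≤ᶻ_ (pw-assoc e (Z j)) W≡ p-lo) p'-hi) ,
        +1≤+1 (squeeze e p'-lo (subst₂ _≤ᶻ_ (cong (_+ 1ℤ) W≡)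
          (trans (pw-assoc e (Z j + 1ℤ)) (cong (pw e *_) (eq (Z j)))) p-hi))
        where
        K K' e : ℕ
        K  = proj₁ (settled j)
        K' = proj₁ (settled (suc j))
        e  = K ℕ.⊔ K'
        p  = proj₂ (settled j)
        p' = proj₂ (settled (suc j))
        W≡ : W (suc e ℕ.+ j) ≡ W (e ℕ.+ suc j)
        W≡ = cong W (sym (ℕₚ.+-suc e j))
        p-lo : pw (suc e) * Z j ≤ᶻ W (suc e ℕ.+ j)
        p-lo = proj₁ (p (suc e) (ℕₚ.m≤n⇒m≤1+n (ℕₚ.m≤m⊔n K K')))
        p-hi : W (suc e ℕ.+ j) + 1ℤ ≤ᶻ pw (suc e) * (Z j + 1ℤ)
        p-hi = proj₂ (p (suc e) (ℕₚ.m≤n⇒m≤1+n (ℕₚ.m≤m⊔n K K')))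
        p'-lo : pw e * Z (suc j) ≤ᶻ W (e ℕ.+ suc j)
        p'-lo = proj₁ (p' e (ℕₚ.m≤n⊔m K K'))
        p'-hi : W (e ℕ.+ suc j) + 1ℤ ≤ᶻ pw e * (Z (suc j) + 1ℤ)
        p'-hi = proj₂ (p' e (ℕₚ.m≤n⊔m K K'))
        eq : ∀ z → + 10 * (z + 1ℤ) ≡ + 10 * z + + 9 + 1ℤ
        eq = solve-∀

      W≤Z : ∀ k → W k ≤ᶻ Z k
      W≤Z k = let K , p = settled k in
        +1≤+1 (squeeze K (lo K k) (proj₂ (p K ℕₚ.≤-refl)))

      Z≤W+1 : ∀ k → Z k ≤ᶻ W k + 1ℤ
      Z≤W+1 k = let K , p = settled k in
        +1≤+1 (squeeze K (proj₁ (p K ℕₚ.≤-refl))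
          (subst (λ v → W (K ℕ.+ k) + 1ℤ ≤ᶻ pw K * v) (sym (ℤₚ.+-assoc (W k) 1ℤ 1ℤ)) (hi K k)))

      Short : ℕ → Set
      Short n = ∃ λ k → n ℕ.≤ k × Z (suc k) + 1ℤ ≤ᶻ + 10 * Z k + + 9

      module AllNines (n : ℕ) (¬short : ¬ Short n) where

        nine : ∀ k → n ℕ.≤ k → Z (suc k) ≡ + 10 * Z k + + 9
        nine k n≤k with Z (suc k) ℤ.≟ + 10 * Z k + + 9
        ... | yes eq = eq
        ... | no  ne = ⊥-elim (¬short (k , n≤k , ≤∧≢⇒+1≤ (proj₂ (Z-step k)) ne))

        nines : ∀ d k → n ℕ.≤ k → Z (d ℕ.+ k) + 1ℤ ≡ pw d * (Z k + 1ℤ)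
        nines zero    k n≤k = sym (pw0-* _)
        nines (suc d) k n≤k = trans (cong (_+ 1ℤ) (nine (d ℕ.+ k) (ℕₚ.≤-trans n≤k (ℕₚ.m≤n+m k d))))
          (trans (eq (Z (d ℕ.+ k)))
            (trans (cong (+ 10 *_) (nines d k n≤k))
              (trans (sym (ℤₚ.*-assoc (+ 10) (pw d) (Z k + 1ℤ)))
                     (cong (_* (Z k + 1ℤ)) (sym (pw-suc d))))))
          where
          eq : ∀ z → + 10 * z + + 9 + 1ℤ ≡ + 10 * (z + 1ℤ)
          eq = solve-∀

        contra : ⊥
        contra with good n
        ... | suc k , ℕ.s≤s n≤k , nn with gap₂ (suc k)
        ... | d , g = impossible (ℤₚ.≤-trans (ℤₚ.≤-trans (ℤₚ.≤-reflexive (e₁ (W d+k)))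
                        (ℤₚ.≤-trans g g')) (ℤₚ.+-monoˡ-≤ 1ℤ (Z≤W+1 d+k)))
          where
          d+k : ℕ
          d+k = d ℕ.+ suc k
          W≢Z : W (suc k) ≢ Z (suc k)
          W≢Z eq = nn (Z k) (trans eq (nine k n≤k))
          W+1≤Z : W (suc k) + 1ℤ ≤ᶻ Z (suc k)
          W+1≤Z = ≤∧≢⇒+1≤ (W≤Z (suc k)) W≢Z
          g' : pw d * (W (suc k) + + 2) ≤ᶻ Z d+k + 1ℤ
          g' = subst (pw d * (W (suc k) + + 2) ≤ᶻ_) (sym (nines d (suc k) (ℕₚ.m≤n⇒m≤1+n n≤k)))
                 (*-monoˡ (0≤pw d) (subst (_≤ᶻ Z (suc k) + 1ℤ) (ℤₚ.+-assoc (W (suc k)) 1ℤ 1ℤ)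
                   (ℤₚ.+-monoˡ-≤ 1ℤ W+1≤Z)))
          e₁ : ∀ w → (w + 1ℤ + 1ℤ) + 1ℤ ≡ w + + 3
          e₁ = solve-∀

      short : ∀ n → Short n
      short n with em {Short n}
      ... | yes p = p
      ... | no ¬p = ⊥-elim (AllNines.contra n ¬p)

    opaque
      carried : ∃ λ z → ∀ k T → NotNine (W (suc k)) →
                + 10 * T ≤ᶻ W (suc k) → W (suc k) ≤ᶻ + 10 * T + + 9 → scaled z k ≡ T
      carried = z , λ k T nn p q → trans (scaled≡ k) (settled-≡ (settled k)
        (settle 0 k T nn (subst (λ c → c * T ≤ᶻ W (suc k)) (sym pw1) p)
          (subst (W (suc k) + 1ℤ ≤ᶻ_) (trans (eq T) (cong (_* (T + 1ℤ)) (sym pw1)))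
            (ℤₚ.+-monoˡ-≤ 1ℤ q))))
        where
        result : ∃ λ z → ∀ k → scaled z k ≡ Z k
        result = fromScaled Z (λ k → proj₁ (Z-step k)) (λ k → proj₂ (Z-step k)) short
        z : ℝ
        z = proj₁ result
        scaled≡ : ∀ k → scaled z k ≡ Z k
        scaled≡ = proj₂ result
        eq : ∀ t → + 10 * t + + 9 + 1ℤ ≡ + 10 * (t + 1ℤ)
        eq = solve-∀

  module _ (em : ExcludedMiddle 0ℓ) where

    opaque
      infinitelyOften : {P : ℕ → Set} → ¬ (∃ λ m → ∀ k → m ℕ.< k → P k) →
                        ∀ m → ∃ λ k → m ℕ.< k × ¬ P k
      infinitelyOften {P} ¬p m with em {∃ λ k → m ℕ.< k × ¬ P k}
      ... | yes q = q
      ... | no ¬q = ⊥-elim (¬p (m , always))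
        where
        always : ∀ k → m ℕ.< k → P k
        always k m<k with em {P k}
        ... | yes p = p
        ... | no ¬p = ⊥-elim (¬q (k , m<k , ¬p))

  opaque
    enumerate : {P : ℕ → Set} → (∀ m → ∃ λ k → m ℕ.< k × P k) →
                ∃ λ κ → Increasing κ × (∀ i → P (κ i))
    enumerate {P} next = κ , (proj₁ (proj₂ (next 0)) , λ i → proj₁ (proj₂ (next (κ i)))) , holds
      where
      κ : ℕ → ℕ
      κ zero    = proj₁ (next 0)
      κ (suc i) = proj₁ (next (κ i))
      holds : ∀ i → P (κ i)
      holds zero    = proj₂ (proj₂ (next 0))
      holds (suc i) = proj₂ (proj₂ (next (κ i)))

  increasing-pos : ∀ κ → Increasing κ → ∀ i → 0 ℕ.< κ i
  increasing-pos κ (p , q) zero    = p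
  increasing-pos κ (p , q) (suc i) = ℕₚ.<-≤-trans ℕ.z<s (ℕₚ.≤-trans (ℕ.s≤s (ℕ.z≤n {κ i})) (q i))

-- Which case of a prescription applies is not decidable, so the operations are
-- functions only in the presence of excluded middle.  Each is the first
-- component of a proof that the prescribed decimal exists.
module Arithmetic (em : ExcludedMiddle 0ℓ) where

  open import Data.Integer using () renaming (_≤_ to _≤ᶻ_; _<_ to _<ᶻ_)
  open Lemmas

  abstract
    sum-exists : ∀ x y → ∃ (IsSum x y)
    sum-exists x y with em {∃ λ m → ∀ k → m ℕ.< k → θ k x ℤ.+ θ k y ≡ + 9}
    ... | yes (m , nines) = z , case₁ m nines (≙-resp {z} u≃ (proj₁ (proj₂ t)))
      where
      N : ℤ
      N = scaled x m ℤ.+ scaled y m ℤ.+ 1ℤ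
      t : ∃ λ t → t ≙ N /10^ m × scaled t m ≡ N
      t = terminal-≙ N m
      z : ℝ
      z = proj₁ t
      u≃ : N /10^ m ≃ trunc x m ℚ.+ trunc y m ℚ.+ 10⁻ m
      u≃ = ℚₚ.≃-sym (ℚₚ.≃-trans (ℚₚ.+-congˡ (10⁻ m) (trunc-+ x y m))
                                (/10^-+ (scaled x m ℤ.+ scaled y m) 1ℤ m))
    ... | no ¬nines = z , case₂ κ inc κ≢9 truncs
      where
      W : ℕ → ℤ
      W k = scaled x k ℤ.+ scaled y k

      W-suc : ∀ k → W (suc k) ≡ + 10 ℤ.* W k ℤ.+ (θ (suc k) x ℤ.+ θ (suc k) y)
      W-suc k = eq (scaled x k) (scaled y k) (θ (suc k) x) (θ (suc k) y)
        where
        eq : ∀ s t a b → (+ 10 ℤ.* s ℤ.+ a) ℤ.+ (+ 10 ℤ.* t ℤ.+ b)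
                       ≡ + 10 ℤ.* (s ℤ.+ t) ℤ.+ (a ℤ.+ b)
        eq = solve-∀

      NotNine-W : ∀ k → θ (suc k) x ℤ.+ θ (suc k) y ≢ + 9 → NotNine (W (suc k))
      NotNine-W k ne = subst NotNine (sym (W-suc k))
        (notNine (W k) _ (0≤+ (θ≥0 x k) (θ≥0 y k)) (ℤₚ.+-mono-≤ (θ≤9 x k) (θ≤9 y k)) ne)

      next : ∀ m → ∃ λ k → m ℕ.< k × θ k x ℤ.+ θ k y ≢ + 9
      next = infinitelyOften em ¬nines

      carrying : Carrying W
      carrying = record
        { lo = λ d k → subst (ℤ._≤ W (d ℕ.+ k)) (sym (ℤₚ.*-distribˡ-+ (pw d) (scaled x k) (scaled y k)))
                 (ℤₚ.+-mono-≤ (scaled-lo x d k) (scaled-lo y d k))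
        ; hi = λ d k → by-slack
                 (0≤+ (0≤+ (slack (scaled-hi x d k)) (slack (scaled-hi y d k))) (0≤pos 1))
                 (eq-hi (pw d) (scaled x k) (scaled y k) (scaled x (d ℕ.+ k)) (scaled y (d ℕ.+ k)))
        ; gap₂ = λ k → let d , p = gap x k in
                 d , by-slack
                   (0≤+ (0≤+ (slack (p d ℕₚ.≤-refl)) (slack (scaled-hi y d k))) (0≤pos 8))
                   (eq-gap (pw d) (scaled x k) (scaled y k) (scaled x (d ℕ.+ k)) (scaled y (d ℕ.+ k)))
        ; good = good
        }
        where
        eq-hi : ∀ p s t s' t' → p ℤ.* (s ℤ.+ t ℤ.+ + 2) ℤ.- (s' ℤ.+ t' ℤ.+ 1ℤ)
              ≡ ((p ℤ.* (s ℤ.+ 1ℤ) ℤ.- (s' ℤ.+ 1ℤ)) ℤ.+ (p ℤ.* (t ℤ.+ 1ℤ) ℤ.- (t' ℤ.+ 1ℤ))) ℤ.+ + 1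
        eq-hi = solve-∀
        eq-gap : ∀ p s t s' t' → p ℤ.* (s ℤ.+ t ℤ.+ + 2) ℤ.- (s' ℤ.+ t' ℤ.+ + 3)
               ≡ ((p ℤ.* (s ℤ.+ 1ℤ) ℤ.- (s' ℤ.+ + 10)) ℤ.+ (p ℤ.* (t ℤ.+ 1ℤ) ℤ.- (t' ℤ.+ 1ℤ))) ℤ.+ + 8
        eq-gap = solve-∀
        good : ∀ m → ∃ λ k → m ℕ.< k × NotNine (W k)
        good m with next m
        ... | suc k , m<k , ne = suc k , m<k , NotNine-W k ne

      enum : ∃ λ κ → Increasing κ × (∀ i → θ (κ i) x ℤ.+ θ (κ i) y ≢ + 9)
      enum = enumerate next
      κ : ℕ → ℕ
      κ = proj₁ enum
      inc : Increasing κ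
      inc = proj₁ (proj₂ enum)
      κ≢9 : ∀ i → θ (κ i) x ℤ.+ θ (κ i) y ≢ + 9
      κ≢9 = proj₂ (proj₂ enum)

      z : ℝ
      z = proj₁ (carried em carrying)

      truncs′ : ∀ k → 0 ℕ.< k → θ k x ℤ.+ θ k y ≢ + 9 →
                HasTrunc (trunc x k ℚ.+ trunc y k) (pred k) (trunc z (pred k))
      truncs′ (suc k) _ ne with terminal-≙ (W (suc k)) (suc k)
      ... | t , t≙ , S≡ = t , ≙-resp {t} (ℚₚ.≃-sym (trunc-+ x y (suc k))) t≙ ,
              trunc-cong t z k (sym (proj₂ (carried em carrying) k (scaled t k) (NotNine-W k ne)
                (subst (+ 10 ℤ.* scaled t k ≤ᶻ_) S≡ (last-lo t k))
                (subst (_≤ᶻ + 10 ℤ.* scaled t k ℤ.+ + 9) S≡ (last-hi t k))))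

      truncs : ∀ i → HasTrunc (trunc x (κ i) ℚ.+ trunc y (κ i)) (pred (κ i))
                              (trunc z (pred (κ i)))
      truncs i = truncs′ (κ i) (increasing-pos κ inc i) (κ≢9 i)

  infixl 6 _+_

  _+_ : ℝ → ℝ → ℝ
  x + y = proj₁ (sum-exists x y)

  +-isSum : ∀ x y → IsSum x y (x + y)
  +-isSum x y = proj₂ (sum-exists x y)

  abstract
    negation-exists : ∀ x → ∃ (IsNegation x)
    negation-exists x with em {∃ λ m → TerminatesAt x m}
    ... | yes (m , stops) = let t , t≙ , _ = terminal-≙ (ℤ.- scaled x m) m in
      t , terminating m stops (≙-resp {t} (ℚₚ.≃-sym (trunc-neg x m)) t≙)
    ... | no ¬stops = z , nonTerminating ¬stops refl digits
      where
      complement : ℕ → Fin 10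
      complement i = opposite (frac x i)
      toℕ-complement : ∀ i → toℕ (complement i) ≡ 9 ℕ.∸ toℕ (frac x i)
      toℕ-complement i = Finₚ.opposite-prop (frac x i)
      nonNine′ : ∀ n → ∃ λ i → n ℕ.≤ i × toℕ (complement i) ℕ.< 9
      nonNine′ n with infinitelyOften em ¬stops n
      ... | suc i , ℕ.s≤s n≤i , ne = i , n≤i , subst (ℕ._< 9) (sym (toℕ-complement i)) (pos _ ne)
        where
        pos : ∀ d → + d ≢ 0ℤ → 9 ℕ.∸ d ℕ.< 9
        pos zero    ne = ⊥-elim (ne refl)
        pos (suc d) ne = ℕ.s≤s (ℕₚ.m∸n≤m 8 d)
      z : ℝ
      z = record { whole = -1ℤ ℤ.- whole x ; frac = complement ; nonNine = nonNine′ }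
      digits : ∀ k → 0 ℕ.< k → θ k z ≡ + 9 ℤ.- θ k x
      digits (suc i) _ = trans (cong +_ (toℕ-complement i))
        (trans (sym (ℤₚ.⊖-≥ d≤9)) (sym (ℤₚ.m-n≡m⊖n 9 (toℕ (frac x i)))))
        where
        d≤9 : toℕ (frac x i) ℕ.≤ 9
        d≤9 = ℕ.s≤s⁻¹ (Finₚ.toℕ<n (frac x i))

  infix 8 -_

  -_ : ℝ → ℝ
  - x = proj₁ (negation-exists x)

  -‿isNegation : ∀ x → IsNegation x (- x)
  -‿isNegation x = proj₂ (negation-exists x)

  -- The prescription for x, y both non-negative.
  data IsNonNegProduct (x y z : ℝ) : Set where
    case₁ : ∀ s → x + y ≤ 10^ s → ∀ m →
            (∀ k → m ℕ.< k → HasDigit (trunc x (k ℕ.+ s) ℚ.* trunc y (k ℕ.+ s)) k (+ 9)) →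
            (∃ λ q → HasTrunc (trunc x (m ℕ.+ s) ℚ.* trunc y (m ℕ.+ s)) m q ×
                     z ≙ (q ℚ.+ 10⁻ m)) →
            IsNonNegProduct x y z
    case₂ : ∀ s → x + y ≤ 10^ s → ∀ κ → Increasing κ →
            (∀ i → ¬ HasDigit (trunc x (κ i ℕ.+ s) ℚ.* trunc y (κ i ℕ.+ s)) (κ i) (+ 9)) →
            (∀ i → HasTrunc (trunc x (κ i ℕ.+ s) ℚ.* trunc y (κ i ℕ.+ s)) (pred (κ i))
                            (trunc z (pred (κ i)))) →
            IsNonNegProduct x y z

  data IsProduct (x y z : ℝ) : Set where
    nonNeg-nonNeg : NonNegative x → NonNegative y → IsNonNegProduct x y z → IsProduct x y z
    neg-neg       : Negative x → Negative y → IsProduct (- x) (- y) z → IsProduct x y z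
    nonNeg-neg    : NonNegative x → Negative y →
                    ∀ w → IsProduct x (- y) w → z ≈ - w → IsProduct x y z
    neg-nonNeg    : Negative x → NonNegative y →
                    ∀ w → IsProduct (- x) y w → z ≈ - w → IsProduct x y z

  abstract
    sum-whole : ∀ x y z → IsSum x y z → whole z ℤ.+ 1ℤ ≤ᶻ whole x ℤ.+ whole y ℤ.+ + 2
    sum-whole x y z (case₁ m _ z≙) = ≙-whole-< z (scaled x m ℤ.+ scaled y m ℤ.+ 1ℤ) m _
      (≙-resp {z} (ℚₚ.≃-trans (ℚₚ.+-congˡ (10⁻ m) (trunc-+ x y m))
                              (/10^-+ (scaled x m ℤ.+ scaled y m) 1ℤ m)) z≙)
      (by-slack (0≤+ (slack (whole-hi x m)) (slack (whole-hi y m)))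
        (eq (pw m) (whole x) (whole y) (scaled x m) (scaled y m)))
      where
      eq : ∀ p a b s t → p ℤ.* (a ℤ.+ b ℤ.+ + 2) ℤ.- (s ℤ.+ t ℤ.+ 1ℤ ℤ.+ 1ℤ)
         ≡ (p ℤ.* (a ℤ.+ 1ℤ) ℤ.- (s ℤ.+ 1ℤ)) ℤ.+ (p ℤ.* (b ℤ.+ 1ℤ) ℤ.- (t ℤ.+ 1ℤ))
      eq = solve-∀
    sum-whole x y z (case₂ κ _ _ truncs) with truncs 0
    ... | t , t≙ , t≃z = ℤₚ.≤-trans (ℤₚ.+-monoˡ-≤ 1ℤ z≤t)
        (≙-whole-< t (scaled x m ℤ.+ scaled y m) m _ (≙-resp {t} (trunc-+ x y m) t≙)
          (by-slack (0≤+ (0≤+ (slack (whole-hi x m)) (slack (whole-hi y m))) (0≤pos 1))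
            (eq (pw m) (whole x) (whole y) (scaled x m) (scaled y m))))
      where
      m j : ℕ
      m = κ 0
      j = pred (κ 0)
      eq : ∀ p a b s t → p ℤ.* (a ℤ.+ b ℤ.+ + 2) ℤ.- (s ℤ.+ t ℤ.+ 1ℤ)
         ≡ (p ℤ.* (a ℤ.+ 1ℤ) ℤ.- (s ℤ.+ 1ℤ)) ℤ.+ (p ℤ.* (b ℤ.+ 1ℤ) ℤ.- (t ℤ.+ 1ℤ)) ℤ.+ 1ℤ
      eq = solve-∀
      z≤t : whole z ≤ᶻ whole t
      z≤t = +1≤+1 (squeeze j (subst (pw j ℤ.* whole z ≤ᶻ_) (sym (trunc-injective t z j t≃z)) (whole-lo z j))
                             (whole-hi t j))

    bound-exists : ∀ x y → NonNegative x → NonNegative y →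
                   ∃ λ s → x + y ≤ 10^ s ×
                   (∀ k → scaled x k ℤ.+ scaled y k ≤ᶻ pw k ℤ.* pw s)
    bound-exists x y x≥0 y≥0 = s , inj₁ (0 , (λ _ ()) , +1≤⇒< (subst (whole (x + y) ℤ.+ 1ℤ ≤ᶻ_) (pw-def s)
        (ℤₚ.≤-trans (sum-whole x y _ (+-isSum x y)) B≤pw))) ,
      λ k → by-slack
        (0≤+ (0≤+ (slack (whole-hi x k)) (slack (whole-hi y k)))
             (0≤+ (0≤* (0≤pw k) (slack B≤pw)) (0≤pos 2)))
        (eq (pw k) (pw s) (whole x) (whole y) (scaled x k) (scaled y k))
      where
      B : ℤ
      B = whole x ℤ.+ whole y ℤ.+ + 2
      s : ℕ
      s = ℤ.∣ B ∣
      B≤pw : B ≤ᶻ pw s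
      B≤pw = subst (_≤ᶻ pw s) (ℤₚ.0≤i⇒+∣i∣≡i (0≤+ (0≤+ x≥0 y≥0) (0≤pos 2)))
               (ℤₚ.≤-trans (ℤₚ.i≤i+j (+ s) 1ℤ) (n<pw s))
      eq : ∀ p q a b s t → p ℤ.* q ℤ.- (s ℤ.+ t)
         ≡ ((p ℤ.* (a ℤ.+ 1ℤ) ℤ.- (s ℤ.+ 1ℤ)) ℤ.+ (p ℤ.* (b ℤ.+ 1ℤ) ℤ.- (t ℤ.+ 1ℤ)))
           ℤ.+ (p ℤ.* (q ℤ.- (a ℤ.+ b ℤ.+ + 2)) ℤ.+ + 2)
      eq = solve-∀

    module NonNegProduct (x y : ℝ) (x≥0 : NonNegative x) (y≥0 : NonNegative y)
      (s : ℕ) (x+y≤ : x + y ≤ 10^ s)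
      (bound : ∀ k → scaled x k ℤ.+ scaled y k ≤ᶻ pw k ℤ.* pw s) where

      K : ℕ → ℕ
      K k = k ℕ.+ s
      P : ℕ → ℤ
      P k = scaled x (K k) ℤ.* scaled y (K k)
      u : ℕ → ℚᵘ
      u k = trunc x (K k) ℚ.* trunc y (K k)
      approx : ∀ k → ∃ λ t → t ≙ P k /10^ (K k ℕ.+ K k) × scaled t (K k ℕ.+ K k) ≡ P k
      approx k = terminal-≙ (P k) (K k ℕ.+ K k)
      τ : ℕ → ℝ
      τ k = proj₁ (approx k)
      τ≙ : ∀ k → τ k ≙ u k
      τ≙ k = ≙-resp {τ k} (ℚₚ.≃-sym (trunc-* x y (K k))) (proj₁ (proj₂ (approx k)))
      W : ℕ → ℤ
      W k = scaled (τ k) k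

      C : ℕ → ℕ
      C k = (k ℕ.+ s) ℕ.+ s
      K+K : ∀ k → C k ℕ.+ k ≡ K k ℕ.+ K k
      K+K k = trans (ℕₚ.+-assoc (k ℕ.+ s) s k) (cong (k ℕ.+ s ℕ.+_) (ℕₚ.+-comm s k))
      τ-scaled : ∀ k → scaled (τ k) (C k ℕ.+ k) ≡ P k
      τ-scaled k = trans (cong (scaled (τ k)) (K+K k)) (proj₂ (proj₂ (approx k)))
      W-lo : ∀ k → pw (C k) ℤ.* W k ≤ᶻ P k
      W-lo k = subst (pw (C k) ℤ.* W k ≤ᶻ_) (τ-scaled k) (scaled-lo (τ k) (C k) k)
      W-hi : ∀ k → P k ℤ.+ 1ℤ ≤ᶻ pw (C k) ℤ.* (W k ℤ.+ 1ℤ)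
      W-hi k = subst (λ w → w ℤ.+ 1ℤ ≤ᶻ pw (C k) ℤ.* (W k ℤ.+ 1ℤ)) (τ-scaled k)
                     (scaled-hi (τ k) (C k) k)
      pw-C : ∀ d k → pw (C (d ℕ.+ k)) ≡ pw (C k) ℤ.* pw d
      pw-C d k = trans (cong pw eq) (pw-+ (C k) d)
        where
        eq : (d ℕ.+ k ℕ.+ s) ℕ.+ s ≡ (k ℕ.+ s ℕ.+ s) ℕ.+ d
        eq = trans (cong (ℕ._+ s) (ℕₚ.+-assoc d k s))
               (trans (ℕₚ.+-assoc d (k ℕ.+ s) s) (ℕₚ.+-comm d (k ℕ.+ s ℕ.+ s)))
      K-+ : ∀ d k → d ℕ.+ K k ≡ K (d ℕ.+ k)
      K-+ d k = sym (ℕₚ.+-assoc d k s)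

      W-mono : ∀ d k → pw d ℤ.* W k ≤ᶻ W (d ℕ.+ k)
      W-mono d k = +1≤+1 (squeeze (C (d ℕ.+ k)) below (W-hi (d ℕ.+ k)))
        where
        A B A' B' D : ℤ
        A  = scaled x (K k)
        B  = scaled y (K k)
        A' = scaled x (K (d ℕ.+ k))
        B' = scaled y (K (d ℕ.+ k))
        D  = pw d
        A-lo : D ℤ.* A ≤ᶻ A'
        A-lo = subst (λ j → D ℤ.* A ≤ᶻ scaled x j) (K-+ d k) (scaled-lo x d (K k))
        B-lo : D ℤ.* B ≤ᶻ B'
        B-lo = subst (λ j → D ℤ.* B ≤ᶻ scaled y j) (K-+ d k) (scaled-lo y d (K k))
        below : pw (C (d ℕ.+ k)) ℤ.* (D ℤ.* W k) ≤ᶻ P (d ℕ.+ k)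
        below = subst (λ c → c ℤ.* (D ℤ.* W k) ≤ᶻ P (d ℕ.+ k)) (sym (pw-C d k))
          (product-lower {A} {B} {A'} {B'} {D} {pw (C k)} {W k}
            (0≤pw d) (scaled≥0 x x≥0 (K k)) (scaled≥0 y y≥0 (K (d ℕ.+ k)))
            A-lo B-lo (W-lo k))

      W-bounded : ∀ d k e →
        scaled x (d ℕ.+ K k) ℤ.+ e ≤ᶻ pw d ℤ.* (scaled x (K k) ℤ.+ 1ℤ) →
        scaled y (d ℕ.+ K k) ℤ.+ e ≤ᶻ pw d ℤ.* (scaled y (K k) ℤ.+ 1ℤ) →
        W (d ℕ.+ k) ℤ.+ 1ℤ ≤ᶻ pw d ℤ.* (W k ℤ.+ + 2) ℤ.- e
      W-bounded d k e A-hi₀ B-hi₀ = squeeze (C (d ℕ.+ k)) (W-lo (d ℕ.+ k)) above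
        where
        A B A' B' D : ℤ
        A  = scaled x (K k)
        B  = scaled y (K k)
        A' = scaled x (K (d ℕ.+ k))
        B' = scaled y (K (d ℕ.+ k))
        D  = pw d
        A-lo : D ℤ.* A ≤ᶻ A'
        A-lo = subst (λ j → D ℤ.* A ≤ᶻ scaled x j) (K-+ d k) (scaled-lo x d (K k))
        A-hi : A' ℤ.+ e ≤ᶻ D ℤ.* (A ℤ.+ 1ℤ)
        A-hi = subst (λ j → scaled x j ℤ.+ e ≤ᶻ D ℤ.* (A ℤ.+ 1ℤ)) (K-+ d k) A-hi₀
        B-hi : B' ℤ.+ e ≤ᶻ D ℤ.* (B ℤ.+ 1ℤ)
        B-hi = subst (λ j → scaled y j ℤ.+ e ≤ᶻ D ℤ.* (B ℤ.+ 1ℤ)) (K-+ d k) B-hi₀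
        A'+B' : A' ℤ.+ B' ≤ᶻ pw (C k) ℤ.* D
        A'+B' = subst (A' ℤ.+ B' ≤ᶻ_)
          (trans (sym (pw-+ (K (d ℕ.+ k)) s)) (pw-C d k)) (bound (K (d ℕ.+ k)))
        above : P (d ℕ.+ k) ℤ.+ 1ℤ ≤ᶻ pw (C (d ℕ.+ k)) ℤ.* (D ℤ.* (W k ℤ.+ + 2) ℤ.- e)
        above = subst (λ c → P (d ℕ.+ k) ℤ.+ 1ℤ ≤ᶻ c ℤ.* (D ℤ.* (W k ℤ.+ + 2) ℤ.- e))
          (sym (pw-C d k))
          (product-upper {A} {B} {A'} {B'} {D} {pw (C k)} {W k} {e}
            (pw-pos d) (scaled≥0 x x≥0 (K k)) (scaled≥0 y y≥0 (K (d ℕ.+ k)))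
            A-lo A-hi B-hi A'+B' (W-hi k))

      result : ∃ (IsNonNegProduct x y)
      result with em {∃ λ m → ∀ k → m ℕ.< k → HasDigit (u k) k (+ 9)}
      ... | yes (m , nines) = let t , t≙ , _ = terminal-≙ (W m ℤ.+ 1ℤ) m in
        t , case₁ s x+y≤ m nines
          (trunc (τ m) m , (τ m , τ≙ m , ℚₚ.≃-refl) ,
           ≙-resp {t} (ℚₚ.≃-sym (ℚₚ.≃-trans (ℚₚ.+-congˡ (10⁻ m) (trunc-scaled (τ m) m))
                                            (/10^-+ (W m) 1ℤ m))) t≙)
      ... | no ¬nines = z , case₂ s x+y≤ κ inc κ≢9
              (λ i → truncs (κ i) (increasing-pos κ inc i) (κ≢9 i))
        where
        next : ∀ m → ∃ λ k → m ℕ.< k × ¬ HasDigit (u k) k (+ 9)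
        next = infinitelyOften em ¬nines

        NotNine-W : ∀ k → ¬ HasDigit (u (suc k)) (suc k) (+ 9) → NotNine (W (suc k))
        NotNine-W k ne = notNine (scaled t k) (θ (suc k) t) (θ≥0 t k)
          (ℤₚ.≤-trans (θ≤9 t k) (by-slack (0≤pos 9) refl))
          (λ eq → ne (t , τ≙ (suc k) , eq))
          where
          t : ℝ
          t = τ (suc k)

        carrying : Carrying W
        carrying = record
          { lo   = W-mono
          ; hi   = λ d k → ℤₚ.≤-trans
                     (W-bounded d k 1ℤ (scaled-hi x d (K k)) (scaled-hi y d (K k)))
                     (by-slack (0≤pos 1) (eq-hi (pw d ℤ.* (W k ℤ.+ + 2))))
          ; gap₂ = λ k → let d₁ , p₁ = gap x (K k)
                             d₂ , p₂ = gap y (K k)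
                             d = d₁ ℕ.⊔ d₂ in
                     d , by-slack
                       (0≤+ (slack (W-bounded d k (+ 10) (p₁ d (ℕₚ.m≤m⊔n d₁ d₂)) (p₂ d (ℕₚ.m≤n⊔m d₁ d₂))))
                            (0≤pos 8))
                       (eq-gap (pw d ℤ.* (W k ℤ.+ + 2)) (W (d ℕ.+ k)))
          ; good = good
          }
          where
          eq-hi : ∀ v → v ℤ.- (v ℤ.- 1ℤ) ≡ + 1
          eq-hi = solve-∀
          eq-gap : ∀ v w → v ℤ.- (w ℤ.+ + 3) ≡ (v ℤ.- + 10 ℤ.- (w ℤ.+ 1ℤ)) ℤ.+ + 8
          eq-gap = solve-∀
          good : ∀ m → ∃ λ k → m ℕ.< k × NotNine (W k)
          good m with next m
          ... | suc k , m<k , ne = suc k , m<k , NotNine-W k ne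

        enum : ∃ λ κ → Increasing κ × (∀ i → ¬ HasDigit (u (κ i)) (κ i) (+ 9))
        enum = enumerate next
        κ : ℕ → ℕ
        κ = proj₁ enum
        inc : Increasing κ
        inc = proj₁ (proj₂ enum)
        κ≢9 : ∀ i → ¬ HasDigit (u (κ i)) (κ i) (+ 9)
        κ≢9 = proj₂ (proj₂ enum)

        z : ℝ
        z = proj₁ (carried em carrying)

        truncs : ∀ k → 0 ℕ.< k → ¬ HasDigit (u k) k (+ 9) →
                 HasTrunc (u k) (pred k) (trunc z (pred k))
        truncs (suc k) _ ne = t , τ≙ (suc k) ,
          trunc-cong t z k (sym (proj₂ (carried em carrying) k (scaled t k)
            (NotNine-W k ne) (last-lo t k) (last-hi t k)))
          where
          t : ℝ
          t = τ (suc k)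

    nonNegProduct-exists : ∀ x y → NonNegative x → NonNegative y → ∃ (IsNonNegProduct x y)
    nonNegProduct-exists x y x≥0 y≥0 = let s , x+y≤ , bound = bound-exists x y x≥0 y≥0 in
      NonNegProduct.result x y x≥0 y≥0 s x+y≤ bound

    -‿nonNegative : ∀ x → Negative x → NonNegative (- x)
    -‿nonNegative x x<0 with - x | -‿isNegation x
    ... | w | terminating m _ w≙ = ≙-whole-≥0 w (ℤ.- scaled x m) m (≙-resp {w} (trunc-neg x m) w≙)
      (by-slack (0≤+ (0≤+ (slack (whole-hi x m)) (0≤* (0≤pw m) (slack (<⇒+1≤ x<0)))) (0≤pos 1))
        (eq (pw m) (whole x) (scaled x m)))
      where
      eq : ∀ p a s → ℤ.- s ℤ.- 0ℤ
         ≡ ((p ℤ.* (a ℤ.+ 1ℤ) ℤ.- (s ℤ.+ 1ℤ)) ℤ.+ p ℤ.* (0ℤ ℤ.- (a ℤ.+ 1ℤ))) ℤ.+ + 1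
      eq = solve-∀
    ... | w | nonTerminating _ w₀ _ = subst (0ℤ ≤ᶻ_) (sym w₀)
      (subst (0ℤ ≤ᶻ_) (eq (whole x)) (slack (<⇒+1≤ x<0)))
      where
      eq : ∀ a → 0ℤ ℤ.- (a ℤ.+ 1ℤ) ≡ -1ℤ ℤ.- a
      eq = solve-∀

    product-exists : ∀ x y → ∃ (IsProduct x y)
    product-exists x y with 0ℤ ℤ.≤? whole x | 0ℤ ℤ.≤? whole y
    ... | yes x≥0 | yes y≥0 = let z , p = nonNegProduct-exists x y x≥0 y≥0 in
      z , nonNeg-nonNeg x≥0 y≥0 p
    ... | no x≱0 | no y≱0 =
      let x<0 = ℤₚ.≰⇒> x≱0; y<0 = ℤₚ.≰⇒> y≱0
          -x≥0 = -‿nonNegative x x<0; -y≥0 = -‿nonNegative y y<0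
          z , p = nonNegProduct-exists (- x) (- y) -x≥0 -y≥0
      in z , neg-neg x<0 y<0 (nonNeg-nonNeg -x≥0 -y≥0 p)
    ... | yes x≥0 | no y≱0 =
      let y<0 = ℤₚ.≰⇒> y≱0
          -y≥0 = -‿nonNegative y y<0
          w , p = nonNegProduct-exists x (- y) x≥0 -y≥0
      in - w , nonNeg-neg x≥0 y<0 w (nonNeg-nonNeg x≥0 -y≥0 p) (digitwise (λ _ → refl))
    ... | no x≱0 | yes y≥0 =
      let x<0 = ℤₚ.≰⇒> x≱0
          -x≥0 = -‿nonNegative x x<0
          w , p = nonNegProduct-exists (- x) y -x≥0 y≥0
      in - w , neg-nonNeg x<0 y≥0 w (nonNeg-nonNeg -x≥0 y≥0 p) (digitwise (λ _ → refl))

  infixl 7 _*_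

  _*_ : ℝ → ℝ → ℝ
  x * y = proj₁ (product-exists x y)

  *-isProduct : ∀ x y → IsProduct x y (x * y)
  *-isProduct x y = proj₂ (product-exists x y)

{-# OPTIONS --safe #-}
module Submission where

-- Write X k = 10^k x_k.  A decimal is determined by X up to a bounded error: if
-- the truncations of x and y differ at all, the difference of X and Y grows
-- without bound, since x has no tail of nines.  Both cases of the digit-wise
-- prescriptions say that Z − (X + Y) is O(1) for z = x + y, that Z + X is O(1)
-- for z = − x, and that 10^k Z − X Y is O(10^k) for z = x y; the ring laws thus
-- become identities of integer sequences modulo such errors.  The reciprocal of
-- x > 0 comes from the greatest integers Z k with Z k · x ≤ 10^k.

open import Level using (0ℓ)
open import Axiom.ExcludedMiddle using (ExcludedMiddle)
open import Defs
open Lemmas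
import Algebra.Consequences.Setoid
open import Data.Nat as ℕ using (ℕ; zero; suc; pred)
import Data.Nat.Properties as ℕₚ
import Data.Nat.Tactic.RingSolver as ℕ-Solver
open import Data.Integer as ℤ using (ℤ; +_; 0ℤ; 1ℤ; -1ℤ; ∣_∣)
import Data.Integer.Properties as ℤₚ
open import Data.Integer.Tactic.RingSolver using (solve-∀)
import Data.Rational.Unnormalised as ℚ
import Data.Rational.Unnormalised.Properties as ℚₚ
open import Data.Product using (∃; _×_; _,_; proj₁; proj₂)
open import Data.Sum using (inj₁; inj₂)
open import Data.Empty using (⊥; ⊥-elim)
open import Relation.Nullary using (¬_; yes; no)
open import Relation.Binary.Bundles using (Setoid)
open import Relation.Binary.Structures using (IsEquivalence)
open import Relation.Binary.PropositionalEquality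
  using (_≡_; refl; sym; trans; cong; cong₂; subst; subst₂)

-- The prescriptions leave m, s and κ free, and κ gives information on z at scattered places only.
-- Bounded errors suffice nevertheless, because each approximating sequence is multiplied by 10^d
-- over d places up to an error of order 10^d: a bound at arbitrarily late places descends to every
-- earlier one. The delicate case is a product with a run of nines. There the digit 9 at place k is
-- read off x_{k+s} y_{k+s}, whose truncation at place k - 1 might differ from the preceding
-- approximation; the bound on x + y and the absence of tails of nines in the factors exclude this.

module DecimalField where

  open import Data.Integer using (_+_; _*_; _-_; -_)
    renaming (_≤_ to _≤ᶻ_; _<_ to _<ᶻ_)

  -- Sequences of order 10^{nk}

  opaque
    unfolding pw

    ∣pw∣ : ∀ k → ∣ pw k ∣ ≡ 10 ℕ.^ k
    ∣pw∣ k = refl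

    +10^≡pw : ∀ k → + (10 ℕ.^ k) ≡ pw k
    +10^≡pw k = refl

  ∣pw*i∣ : ∀ k i → ∣ pw k * i ∣ ≡ 10 ℕ.^ k ℕ.* ∣ i ∣
  ∣pw*i∣ k i = trans (ℤₚ.abs-* (pw k) i) (cong (ℕ._* ∣ i ∣) (∣pw∣ k))

  -n≤i≤n⇒∣i∣≤n : ∀ {i n} → - (+ n) ≤ᶻ i → i ≤ᶻ + n → ∣ i ∣ ℕ.≤ n
  -n≤i≤n⇒∣i∣≤n {+ m}                _              (ℤ.+≤+ m≤n) = m≤n
  -n≤i≤n⇒∣i∣≤n {ℤ.-[1+ m ]} {suc n} (ℤ.-≤- m≤n) _           = ℕ.s≤s m≤n

  ∣i∣≤n⇒i≤n : ∀ {i n} → ∣ i ∣ ℕ.≤ n → i ≤ᶻ + n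
  ∣i∣≤n⇒i≤n {+ m}        m≤n = ℤ.+≤+ m≤n
  ∣i∣≤n⇒i≤n {ℤ.-[1+ m ]} _   = ℤ.-≤+

  0≤i≤j⇒∣i∣≤∣j∣ : ∀ {i j} → 0ℤ ≤ᶻ i → i ≤ᶻ j → ∣ i ∣ ℕ.≤ ∣ j ∣
  0≤i≤j⇒∣i∣≤∣j∣ (ℤ.+≤+ _) (ℤ.+≤+ m≤n) = m≤n

  10^>0 : ∀ k → 1 ℕ.≤ 10 ℕ.^ k
  10^>0 = ℕₚ.m^n>0 10

  record O (n : ℕ) (f : ℕ → ℤ) : Set where
    constructor bounded
    field
      factor : ℕ
      bound  : ∀ k → ∣ f k ∣ ℕ.≤ factor ℕ.* (10 ℕ.^ k) ℕ.^ n

  O-cong : ∀ {n f g} → (∀ k → f k ≡ g k) → O n f → O n g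
  O-cong f≡g (bounded C p) = bounded C λ k → subst (λ i → ∣ i ∣ ℕ.≤ _) (f≡g k) (p k)

  O-+ : ∀ {n f g} → O n f → O n g → O n (λ k → f k + g k)
  O-+ {n} {f} {g} (bounded C p) (bounded D q) = bounded (C ℕ.+ D) λ k →
    ℕₚ.≤-trans (ℤₚ.∣i+j∣≤∣i∣+∣j∣ (f k) (g k))
      (ℕₚ.≤-trans (ℕₚ.+-mono-≤ (p k) (q k))
        (ℕₚ.≤-reflexive (sym (ℕₚ.*-distribʳ-+ ((10 ℕ.^ k) ℕ.^ n) C D))))

  O-neg : ∀ {n f} → O n f → O n (λ k → - f k)
  O-neg {n} {f} (bounded C p) = bounded C λ k →
    subst (ℕ._≤ C ℕ.* (10 ℕ.^ k) ℕ.^ n) (sym (ℤₚ.∣-i∣≡∣i∣ (f k))) (p k)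

  O-- : ∀ {n f g} → O n f → O n g → O n (λ k → f k - g k)
  O-- p q = O-+ p (O-neg q)

  O-* : ∀ {m n f g} → O m f → O n g → O (m ℕ.+ n) (λ k → f k * g k)
  O-* {m} {n} {f} {g} (bounded C p) (bounded D q) = bounded (C ℕ.* D) λ k →
    subst₂ ℕ._≤_ (sym (ℤₚ.abs-* (f k) (g k)))
      (trans (eq C D ((10 ℕ.^ k) ℕ.^ m) ((10 ℕ.^ k) ℕ.^ n))
             (cong (C ℕ.* D ℕ.*_) (sym (ℕₚ.^-distribˡ-+-* (10 ℕ.^ k) m n))))
      (ℕₚ.*-mono-≤ (p k) (q k))
    where
    eq : ∀ c d a b → (c ℕ.* a) ℕ.* (d ℕ.* b) ≡ (c ℕ.* d) ℕ.* (a ℕ.* b)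
    eq = ℕ-Solver.solve-∀

  O-const : ∀ i → O 0 (λ _ → i)
  O-const i = bounded ∣ i ∣ λ k → ℕₚ.≤-reflexive (sym (ℕₚ.*-identityʳ ∣ i ∣))

  O-zero : ∀ {n} → O n (λ _ → 0ℤ)
  O-zero = bounded 0 λ k → ℕ.z≤n

  O-pw : O 1 pw
  O-pw = bounded 1 λ k → ℕₚ.≤-reflexive
    (trans (∣pw∣ k) (sym (trans (ℕₚ.*-identityˡ _) (ℕₚ.^-identityʳ (10 ℕ.^ k)))))

  O-suc : ∀ {n f} → O n f → O (suc n) f
  O-suc {n} (bounded C p) = bounded C λ k → ℕₚ.≤-trans (p k)
    (ℕₚ.*-monoʳ-≤ C (ℕₚ.m≤n*m ((10 ℕ.^ k) ℕ.^ n) (10 ℕ.^ k) {{10^≢0 k}}))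

  O-within : ∀ {n f g} → (∀ k → 0ℤ ≤ᶻ f k) → (∀ k → f k ≤ᶻ g k) → O n g → O n f
  O-within 0≤f f≤g (bounded C p) = bounded C λ k →
    ℕₚ.≤-trans (0≤i≤j⇒∣i∣≤∣j∣ (0≤f k) (f≤g k)) (p k)

  -- A factor of size at least 10^{mk} may be divided out at the price of m orders. It serves with m
  -- = 1 for `pw` and with m = 0 for a nonzero constant.
  O-cancel : ∀ m {n} {f : ℕ → ℤ} (g : ℕ → ℤ) → (∀ k → (10 ℕ.^ k) ℕ.^ m ℕ.≤ ∣ g k ∣) →
             O (m ℕ.+ n) (λ k → g k * f k) → O n f
  O-cancel m {n} {f} g g-large (bounded C p) = bounded C λ k →
    ℕₚ.*-cancelˡ-≤ ((10 ℕ.^ k) ℕ.^ m) {{ℕₚ.m^n≢0 (10 ℕ.^ k) m {{10^≢0 k}}}}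
      (ℕₚ.≤-trans (ℕₚ.*-monoˡ-≤ ∣ f k ∣ (g-large k))
        (subst₂ ℕ._≤_ (ℤₚ.abs-* (g k) (f k))
          (trans (cong (C ℕ.*_) (ℕₚ.^-distribˡ-+-* (10 ℕ.^ k) m n))
                 (eq C ((10 ℕ.^ k) ℕ.^ m) ((10 ℕ.^ k) ℕ.^ n)))
          (p k)))
    where
    eq : ∀ c a b → c ℕ.* (a ℕ.* b) ≡ a ℕ.* (c ℕ.* b)
    eq = ℕ-Solver.solve-∀

  O-cancel-pw : ∀ {n} {f : ℕ → ℤ} → O (suc n) (λ k → pw k * f k) → O n f
  O-cancel-pw {n} {f} = O-cancel 1 {n} {f} pw λ k → ℕₚ.≤-reflexive
    (trans (ℕₚ.^-identityʳ (10 ℕ.^ k)) (sym (∣pw∣ k)))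

  -- f k behaves as 10^k v + O(1) for some number v.
  record Coherent (f : ℕ → ℤ) : Set where
    constructor coherent
    field
      factor : ℕ
      drift  : ∀ d k → ∣ f (d ℕ.+ k) - pw d * f k ∣ ℕ.≤ factor ℕ.* 10 ℕ.^ d

  Coherent-+ : ∀ {f g} → Coherent f → Coherent g → Coherent (λ k → f k + g k)
  Coherent-+ {f} {g} (coherent C p) (coherent D q) = coherent (C ℕ.+ D) λ d k →
    subst₂ ℕ._≤_ (cong ∣_∣ (eq (f (d ℕ.+ k)) (g (d ℕ.+ k)) (pw d) (f k) (g k)))
      (sym (ℕₚ.*-distribʳ-+ (10 ℕ.^ d) C D))
      (ℕₚ.≤-trans (ℤₚ.∣i+j∣≤∣i∣+∣j∣ (f (d ℕ.+ k) - pw d * f k) (g (d ℕ.+ k) - pw d * g k))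
                  (ℕₚ.+-mono-≤ (p d k) (q d k)))
    where
    eq : ∀ f' g' p f g → (f' - p * f) + (g' - p * g) ≡ (f' + g') - p * (f + g)
    eq = solve-∀

  Coherent-neg : ∀ {f} → Coherent f → Coherent (λ k → - f k)
  Coherent-neg {f} (coherent C p) = coherent C λ d k →
    subst (ℕ._≤ C ℕ.* 10 ℕ.^ d)
      (trans (sym (ℤₚ.∣-i∣≡∣i∣ (f (d ℕ.+ k) - pw d * f k)))
             (cong ∣_∣ (eq (f (d ℕ.+ k)) (pw d) (f k))))
      (p d k)
    where
    eq : ∀ f' p f → - (f' - p * f) ≡ - f' - p * (- f)
    eq = solve-∀

  Coherent-- : ∀ {f g} → Coherent f → Coherent g → Coherent (λ k → f k - g k)
  Coherent-- p q = Coherent-+ p (Coherent-neg q)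

  Coherent-within : ∀ {f} C → (∀ d k → pw d * f k ≤ᶻ f (d ℕ.+ k)) →
                    (∀ d k → f (d ℕ.+ k) ≤ᶻ pw d * (f k + + C)) → Coherent f
  Coherent-within {f} C lo hi = coherent C λ d k →
    ℕₚ.≤-trans (0≤i≤j⇒∣i∣≤∣j∣ {j = pw d * + C} (slack (lo d k))
        (by-slack (slack (hi d k)) (eq (f (d ℕ.+ k)) (pw d) (f k) (+ C))))
      (ℕₚ.≤-reflexive (trans (∣pw*i∣ d (+ C)) (ℕₚ.*-comm (10 ℕ.^ d) C)))
    where
    eq : ∀ f' p f c → p * c - (f' - p * f) ≡ p * (f + c) - f'
    eq = solve-∀

  scaled-coherent : ∀ x → Coherent (scaled x)
  scaled-coherent x = Coherent-within 1 (scaled-lo x) λ d k →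
    ℤₚ.≤-trans (ℤₚ.i≤i+j _ 1ℤ) (scaled-hi x d k)

  -- The drift from place 0 to place k reads f k = 10^k f 0 + O(10^k).
  Coherent-O₁ : ∀ {f} → Coherent f → O 1 f
  Coherent-O₁ {f} (coherent C p) = bounded (C ℕ.+ ∣ f 0 ∣) λ k →
    subst₂ ℕ._≤_ (cong ∣_∣ (trans (cong (λ j → f j - pw k * f 0 + pw k * f 0) (ℕₚ.+-identityʳ k))
                                    (eq (f k) (pw k * f 0))))
      (trans (cong (C ℕ.* 10 ℕ.^ k ℕ.+_) (∣pw*i∣ k (f 0))) (trans (eq' C (10 ℕ.^ k) ∣ f 0 ∣)
        (cong ((C ℕ.+ ∣ f 0 ∣) ℕ.*_) (sym (ℕₚ.^-identityʳ (10 ℕ.^ k))))))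
      (ℕₚ.≤-trans (ℤₚ.∣i+j∣≤∣i∣+∣j∣ (f (k ℕ.+ 0) - pw k * f 0) (pw k * f 0))
                  (ℕₚ.+-monoˡ-≤ _ (p k 0)))
    where
    eq : ∀ a b → a - b + b ≡ a
    eq = solve-∀
    eq' : ∀ c p a → c ℕ.* p ℕ.+ p ℕ.* a ≡ (c ℕ.+ a) ℕ.* p
    eq' = ℕ-Solver.solve-∀

  scaled-O₁ : ∀ x → O 1 (scaled x)
  scaled-O₁ x = Coherent-O₁ (scaled-coherent x)

  -- Drift makes f (d + k) equal to 10^d f k up to D 10^d, so a bound C at the later place gives
  -- 10^d |f k| ≤ C + D 10^d ≤ 10^d (C + D). The bound C + D does not depend on d, so it is enough
  -- to control f at arbitrarily late places.
  frequently⇒O₀ : ∀ {f} C → Coherent f → (∀ k → ∃ λ d → ∣ f (d ℕ.+ k) ∣ ℕ.≤ C) → O 0 f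
  frequently⇒O₀ {f} C (coherent D q) frequently = bounded (C ℕ.+ D) λ k →
    let d , p = frequently k in
    subst (∣ f k ∣ ℕ.≤_) (sym (ℕₚ.*-identityʳ (C ℕ.+ D)))
      (ℕₚ.*-cancelˡ-≤ (10 ℕ.^ d) {{10^≢0 d}}
        (subst (ℕ._≤ 10 ℕ.^ d ℕ.* (C ℕ.+ D))
          (trans (cong ∣_∣ (eq (f (d ℕ.+ k)) (pw d * f k))) (∣pw*i∣ d (f k)))
          (ℕₚ.≤-trans (ℤₚ.∣i-j∣≤∣i∣+∣j∣ (f (d ℕ.+ k)) (f (d ℕ.+ k) - pw d * f k))
            (ℕₚ.≤-trans (ℕₚ.+-mono-≤ (ℕₚ.≤-trans p (ℕₚ.m≤n*m C (10 ℕ.^ d) {{10^≢0 d}})) (q d k))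
              (ℕₚ.≤-reflexive (eq' (10 ℕ.^ d) C D))))))
    where
    eq : ∀ a b → a - (a - b) ≡ b
    eq = solve-∀
    eq' : ∀ p c d → p ℕ.* c ℕ.+ d ℕ.* p ≡ p ℕ.* (c ℕ.+ d)
    eq' = ℕ-Solver.solve-∀

  -- Decimals and their scaled truncations

  scaled-θ : ∀ {x y} → (∀ k → scaled x k ≡ scaled y k) → x ≈ y
  scaled-θ {x} {y} eq = digitwise digits
    where
    digit : ∀ z k → θ (suc k) z ≡ scaled z (suc k) - + 10 * scaled z k
    digit z k = lemma (scaled z k) (θ (suc k) z)
      where
      lemma : ∀ s t → t ≡ (+ 10 * s + t) - + 10 * s
      lemma = solve-∀
    digits : ∀ k → θ k x ≡ θ k y
    digits zero    = eq 0
    digits (suc k) = trans (digit x k)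
      (trans (cong₂ (λ s t → t - + 10 * s) (eq k) (eq (suc k))) (sym (digit y k)))

  scaled-cong : ∀ {x y} → x ≈ y → ∀ k → scaled x k ≡ scaled y k
  scaled-cong eq zero    = θ-≡ eq 0
  scaled-cong eq (suc k) = cong₂ (λ s t → + 10 * s + t) (scaled-cong eq k) (θ-≡ eq (suc k))

  scaled-fromℤ : ∀ n k → scaled (fromℤ n) k ≡ pw k * n
  scaled-fromℤ n zero    = sym (pw0-* n)
  scaled-fromℤ n (suc k) = trans (ℤₚ.+-identityʳ _) (trans (cong (+ 10 *_) (scaled-fromℤ n k))
    (trans (sym (ℤₚ.*-assoc (+ 10) (pw k) n)) (cong (_* n) (sym (pw-suc k)))))

  -- A difference of one unit alone could persist forever, as for 0.999... and 1.000.... Since x has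
  -- no tail of nines, `gap` enlarges it to ten units at some place j; after n more places the tail
  -- of x consumes at most one of these ten, and more than 9 · 10^n ≥ n remains.
  scaled-separate : ∀ x y k → scaled x k + 1ℤ ≤ᶻ scaled y k →
                    ∀ n → ∃ λ j → scaled x j + + n ≤ᶻ scaled y j
  scaled-separate x y k X<Y n = n ℕ.+ j , by-slack
      (0≤+ (0≤+ (slack (scaled-lo y n j)) (0≤* (0≤pw n) (slack apart)))
           (0≤+ (slack (scaled-hi x n j))
                (0≤+ (0≤* (0≤pos 9) (slack (n<pw n))) (0≤+ (0≤* (0≤pos 8) (0≤pos n)) (0≤pos 10)))))
      (eq (scaled y (n ℕ.+ j)) (scaled x (n ℕ.+ j)) (pw n) (scaled y j) (scaled x j) (+ n))
    where
    d j : ℕ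
    d = proj₁ (gap x k)
    j = d ℕ.+ k
    apart : scaled x j + + 10 ≤ᶻ scaled y j
    apart = ℤₚ.≤-trans (proj₂ (gap x k) d ℕₚ.≤-refl)
      (ℤₚ.≤-trans (*-monoˡ (0≤pw d) X<Y) (scaled-lo y d k))
    eq : ∀ y' x' p y x n → y' - (x' + n) ≡
         ((y' - p * y) + p * (y - (x + + 10))) +
         ((p * (x + 1ℤ) - (x' + 1ℤ)) + (+ 9 * (p - (n + 1ℤ)) + (+ 8 * n + + 10)))
    eq = solve-∀

  scaled-near⇒≤ : ∀ x y → O 0 (λ k → scaled y k - scaled x k) → ∀ k → scaled y k ≤ᶻ scaled x k
  scaled-near⇒≤ x y (bounded C p) k = ℤₚ.≮⇒≥ λ X<Y →
    -- `C ℕ.* 1` is the bound of an `O 0` sequence in its literal form; one more than it is out of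
    -- reach.
    let j , far = scaled-separate x y k (<⇒+1≤ X<Y) (suc (C ℕ.* 1))
    in too-far j far
    where
    eq : ∀ y x c → y - x - (c + 1ℤ) ≡ y - (x + (1ℤ + c))
    eq = solve-∀
    too-far : ∀ j → scaled x j + + suc (C ℕ.* 1) ≤ᶻ scaled y j → ⊥
    too-far j far = impossible {+ (C ℕ.* 1)} (ℤₚ.≤-trans
      (by-slack (slack far) (eq (scaled y j) (scaled x j) (+ (C ℕ.* 1))))
      (∣i∣≤n⇒i≤n {scaled y j - scaled x j} (p j)))

  near⇒≈ : ∀ x y → O 0 (λ k → scaled x k - scaled y k) → x ≈ y
  near⇒≈ x y p = scaled-θ λ k → ℤₚ.≤-antisym (scaled-near⇒≤ y x p k)
    (scaled-near⇒≤ x y (O-cong (λ k → eq (scaled x k) (scaled y k)) (O-neg p)) k)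
    where
    eq : ∀ x y → - (x - y) ≡ y - x
    eq = solve-∀

  terminates-scaled : ∀ {t l} → TerminatesAt t l → ∀ d → scaled t (d ℕ.+ l) ≡ pw d * scaled t l
  terminates-scaled         stops zero    = sym (pw0-* _)
  terminates-scaled {t} {l} stops (suc d) =
    trans (cong₂ (λ s a → + 10 * s + a) (terminates-scaled {t} stops d)
                 (stops (suc (d ℕ.+ l)) (ℕ.s≤s (ℕₚ.m≤n+m l d))))
      (trans (eq (pw d) (scaled t l)) (cong (_* scaled t l) (sym (pw-suc d))))
    where
    eq : ∀ p s → + 10 * (p * s) + 0ℤ ≡ (+ 10 * p) * s
    eq = solve-∀

  -- The place l where t is known to stop may lie beyond m. At place l + (d + m) both have been
  -- passed and the value 10^l (10^d N) is exact; being a multiple of 10^l, it determines the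
  -- truncation l places earlier.
  ≙-scaled : ∀ t N m → t ≙ N /10^ m → ∀ d → scaled t (d ℕ.+ m) ≡ pw d * N
  ≙-scaled t N m (l , stops , t≃) d = ℤₚ.≤-antisym
    (cancel-≤ l (ℤₚ.≤-trans (scaled-lo t l (d ℕ.+ m)) (ℤₚ.≤-reflexive far)))
    (+1≤+1 (cancel-< l (subst (λ w → w + 1ℤ ≤ᶻ pw l * (scaled t (d ℕ.+ m) + 1ℤ)) far
                              (scaled-hi t l (d ℕ.+ m)))))
    where
    S≡ : scaled t l * pw m ≡ N * pw l
    S≡ = /10^-≃⁻¹ (scaled t l) l N m (ℚₚ.≃-trans (ℚₚ.≃-sym (trunc-scaled t l)) t≃)
    eq₁ : ∀ p q s → (p * q) * s ≡ p * (s * q)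
    eq₁ = solve-∀
    eq₂ : ∀ p q n → p * (n * q) ≡ q * (p * n)
    eq₂ = solve-∀
    far : scaled t (l ℕ.+ (d ℕ.+ m)) ≡ pw l * (pw d * N)
    far = trans (cong (scaled t) (ℕₚ.+-comm l (d ℕ.+ m)))
      (trans (terminates-scaled {t} stops (d ℕ.+ m))
        (trans (cong (_* scaled t l) (pw-+ d m))
          (trans (eq₁ (pw d) (pw m) (scaled t l))
            (trans (cong (pw d *_) S≡) (eq₂ (pw d) (pw l) N)))))

  -- Sums and negatives

  -- Adding one turns the recursion w ↦ 10 w + 9 into multiplication by ten.
  nines : ∀ {W : ℕ → ℤ} {m} → (∀ k → m ℕ.≤ k → W (suc k) ≡ + 10 * W k + + 9) →
          ∀ d → W (d ℕ.+ m) + 1ℤ ≡ pw d * (W m + 1ℤ)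
  nines         nine zero    = sym (pw0-* _)
  nines {W} {m} nine (suc d) =
    trans (cong (_+ 1ℤ) (nine (d ℕ.+ m) (ℕₚ.m≤n+m m d)))
      (trans (eq₁ (W (d ℕ.+ m)))
        (trans (cong (+ 10 *_) (nines {W} nine d))
          (trans (sym (ℤₚ.*-assoc (+ 10) (pw d) (W m + 1ℤ)))
                 (cong (_* (W m + 1ℤ)) (sym (pw-suc d))))))
    where
    eq₁ : ∀ w → + 10 * w + + 9 + 1ℤ ≡ + 10 * (w + 1ℤ)
    eq₁ = solve-∀

  -- W k stands for 10^k times the k-th approximation x_k + y_k, respectively
  -- (x_{k+s} y_{k+s})_k, in the prescription of a sum or product z.
  module _ {W : ℕ → ℤ} (W-coherent : Coherent W) (z : ℝ) where

    private
      Z-W-coherent : Coherent (λ k → scaled z k - W k)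
      Z-W-coherent = Coherent-- (scaled-coherent z) W-coherent

    -- The carried value never meets the run of nines: from place m on, the two stay exactly one
    -- unit apart.
    carry-limit : ∀ m → (∀ k → m ℕ.≤ k → W (suc k) ≡ + 10 * W k + + 9) →
                  z ≙ (W m + 1ℤ) /10^ m → O 0 (λ k → scaled z k - W k)
    carry-limit m nine z≙ = frequently⇒O₀ 1 Z-W-coherent λ k → m ,
      ℕₚ.≤-reflexive (cong ∣_∣ (trans (cong (λ j → scaled z j - W j) (ℕₚ.+-comm m k)) (off-by-one k)))
      where
      eq : ∀ w → w + 1ℤ - w ≡ 1ℤ
      eq = solve-∀
      off-by-one : ∀ k → scaled z (k ℕ.+ m) - W (k ℕ.+ m) ≡ 1ℤ
      off-by-one k = trans
        (cong (_- W (k ℕ.+ m)) (trans (≙-scaled z (W m + 1ℤ) m z≙ k) (sym (nines {W} nine k))))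
        (eq (W (k ℕ.+ m)))

    -- The decimals t and z agree one place before κ i, so at κ i they differ by a difference of two
    -- digits, at most 9. As κ k ≥ k, such places occur beyond every k.
    truncation-limit : ∀ κ → Increasing κ →
      (∀ i → ∃ λ t → scaled t (κ i) ≡ W (κ i) × scaled t (pred (κ i)) ≡ scaled z (pred (κ i))) →
      O 0 (λ k → scaled z k - W k)
    truncation-limit κ inc agree = frequently⇒O₀ 9 Z-W-coherent λ k →
      κ k ℕ.∸ k , subst (λ j → ∣ scaled z j - W j ∣ ℕ.≤ 9) (sym (ℕₚ.m∸n+n≡m (i≤κ k)))
                        (near (κ k) (increasing-pos κ inc k) (agree k))
      where
      i≤κ : ∀ i → i ℕ.≤ κ i
      i≤κ zero    = ℕ.z≤n
      i≤κ (suc i) = ℕₚ.≤-trans (ℕ.s≤s (i≤κ i)) (proj₂ inc i)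
      near : ∀ j → 0 ℕ.< j →
             (∃ λ t → scaled t j ≡ W j × scaled t (pred j) ≡ scaled z (pred j)) →
             ∣ scaled z j - W j ∣ ℕ.≤ 9
      near (suc j) _ (t , t≡W , t≡z) = subst (λ w → ∣ scaled z (suc j) - w ∣ ℕ.≤ 9) t≡W
        (subst (ℕ._≤ 9)
          (cong ∣_∣ (trans (eq (scaled z j) (θ (suc j) z) (θ (suc j) t))
            (cong (λ s → scaled z (suc j) - (+ 10 * s + θ (suc j) t)) (sym t≡z))))
          (-n≤i≤n⇒∣i∣≤n {θ (suc j) z - θ (suc j) t}
            (by-slack (0≤+ (slack (θ≤9 t j)) (θ≥0 z j)) (eq-lo (θ (suc j) z) (θ (suc j) t)))
            (by-slack (0≤+ (slack (θ≤9 z j)) (θ≥0 t j)) (eq-hi (θ (suc j) z) (θ (suc j) t)))))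
        where
        eq : ∀ s a b → a - b ≡ (+ 10 * s + a) - (+ 10 * s + b)
        eq = solve-∀
        eq-lo : ∀ a b → (a - b) - - (+ 9) ≡ (+ 9 - b) + a
        eq-lo = solve-∀
        eq-hi : ∀ a b → + 9 - (a - b) ≡ (+ 9 - a) + b
        eq-hi = solve-∀

  sum-near : ∀ {x y z} → IsSum x y z → O 0 (λ k → scaled z k - (scaled x k + scaled y k))
  sum-near {x} {y} {z} = λ where
      (case₁ m nine z≙) → carry-limit W-coherent z m (W-nine m nine)
        (≙-resp {z} (ℚₚ.≃-trans (ℚₚ.+-congˡ (10⁻ m) (trunc-+ x y m)) (/10^-+ (W m) 1ℤ m)) z≙)
      (case₂ κ inc _ truncs) → truncation-limit W-coherent z κ inc λ i →
        let t , t≙ , t≃z = truncs i in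
        t , trans (≙-scaled t (W (κ i)) (κ i) (≙-resp {t} (trunc-+ x y (κ i)) t≙) 0) (pw0-* _) ,
        trunc-injective t z (pred (κ i)) t≃z
    where
    W : ℕ → ℤ
    W k = scaled x k + scaled y k
    W-coherent : Coherent W
    W-coherent = Coherent-+ (scaled-coherent x) (scaled-coherent y)
    W-nine : ∀ m → (∀ k → m ℕ.< k → θ k x + θ k y ≡ + 9) →
             ∀ k → m ℕ.≤ k → W (suc k) ≡ + 10 * W k + + 9
    W-nine m nine k m≤k = trans (eq (scaled x k) (scaled y k) (θ (suc k) x) (θ (suc k) y))
      (cong (λ i → + 10 * W k + i) (nine (suc k) (ℕ.s≤s m≤k)))
      where
      eq : ∀ s t a b → (+ 10 * s + a) + (+ 10 * t + b) ≡ + 10 * (s + t) + (a + b)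
      eq = solve-∀

  negation-near : ∀ {x z} → IsNegation x z → O 0 (λ k → scaled z k + scaled x k)
  negation-near {x} {z} (terminating m stops z≙) =
    frequently⇒O₀ 0 (Coherent-+ (scaled-coherent z) (scaled-coherent x)) λ k → m ,
      ℕₚ.≤-reflexive (cong ∣_∣ (trans (cong (λ j → scaled z j + scaled x j) (ℕₚ.+-comm m k))
        (trans (cong₂ _+_ (≙-scaled z (- scaled x m) m (≙-resp {z} (trunc-neg x m) z≙) k)
                          (terminates-scaled {x} stops k))
               (eq (pw k) (scaled x m)))))
    where
    eq : ∀ p s → p * - s + p * s ≡ 0ℤ
    eq = solve-∀
  -- The whole parts add up to -1 and all later digits to 9, and -1 is the fixed point of i ↦ 10 i +
  -- 9.
  negation-near {x} {z} (nonTerminating _ z₀ z₊) = O-cong (λ k → sym (minus-one k)) (O-const -1ℤ)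
    where
    eq₀ : ∀ a → (-1ℤ - a) + a ≡ -1ℤ
    eq₀ = solve-∀
    eq₁ : ∀ s t a → (+ 10 * s + (+ 9 - a)) + (+ 10 * t + a) ≡ + 10 * (s + t) + + 9
    eq₁ = solve-∀
    minus-one : ∀ k → scaled z k + scaled x k ≡ -1ℤ
    minus-one zero    = trans (cong (_+ θ 0 x) z₀) (eq₀ (θ 0 x))
    minus-one (suc k) = trans
      (cong (λ a → (+ 10 * scaled z k + a) + (+ 10 * scaled x k + θ (suc k) x)) (z₊ (suc k) ℕ.z<s))
      (trans (eq₁ (scaled z k) (scaled x k) (θ (suc k) x))
             (cong (λ i → + 10 * i + + 9) (minus-one k)))

  -- Products of non-negative decimals

  module Product (x y : ℝ) (x≥0 : NonNegative x) (y≥0 : NonNegative y) (s : ℕ)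
    (x+y-bound : ∀ k → scaled x k + scaled y k ≤ᶻ pw k * pw s) where

    -- `P k` carries 2 (k + s) decimal places; dropping `C k` = k + 2s of them leaves k.
    C : ℕ → ℕ
    C k = k ℕ.+ s ℕ.+ s

    P W : ℕ → ℤ
    P k = scaled x (k ℕ.+ s) * scaled y (k ℕ.+ s)
    W k = floor10 (P k) (C k)

    W-lo : ∀ k → pw (C k) * W k ≤ᶻ P k
    W-lo k = floor10-lo (P k) (C k)

    W-hi : ∀ k → P k + 1ℤ ≤ᶻ pw (C k) * (W k + 1ℤ)
    W-hi k = floor10-hi (P k) (C k)

    pw-C-+ : ∀ d k → pw (C (d ℕ.+ k)) ≡ pw (C k) * pw d
    pw-C-+ d k = trans (cong pw (eq d k s)) (pw-+ (C k) d)
      where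
      eq : ∀ d k s → d ℕ.+ k ℕ.+ s ℕ.+ s ≡ k ℕ.+ s ℕ.+ s ℕ.+ d
      eq = ℕ-Solver.solve-∀

    lo : ∀ z d k → pw d * scaled z (k ℕ.+ s) ≤ᶻ scaled z (d ℕ.+ k ℕ.+ s)
    lo z d k = subst (λ j → pw d * scaled z (k ℕ.+ s) ≤ᶻ scaled z j)
                     (sym (ℕₚ.+-assoc d k s)) (scaled-lo z d (k ℕ.+ s))

    W-mono : ∀ d k → pw d * W k ≤ᶻ W (d ℕ.+ k)
    W-mono d k = +1≤+1 (squeeze (C (d ℕ.+ k))
      (subst (λ c → c * (pw d * W k) ≤ᶻ P (d ℕ.+ k)) (sym (pw-C-+ d k))
        (product-lower {scaled x (k ℕ.+ s)} {scaled y (k ℕ.+ s)}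
                       {scaled x (d ℕ.+ k ℕ.+ s)} {scaled y (d ℕ.+ k ℕ.+ s)}
                       {pw d} {pw (C k)} {W k}
          (0≤pw d) (scaled≥0 x x≥0 (k ℕ.+ s)) (scaled≥0 y y≥0 (d ℕ.+ k ℕ.+ s))
          (lo x d k) (lo y d k) (W-lo k)))
      (W-hi (d ℕ.+ k)))

    W-upper : ∀ d k e →
              scaled x (d ℕ.+ (k ℕ.+ s)) + e ≤ᶻ pw d * (scaled x (k ℕ.+ s) + 1ℤ) →
              scaled y (d ℕ.+ (k ℕ.+ s)) + e ≤ᶻ pw d * (scaled y (k ℕ.+ s) + 1ℤ) →
              W (d ℕ.+ k) + 1ℤ ≤ᶻ pw d * (W k + + 2) - e
    W-upper d k e x-hi y-hi = squeeze (C (d ℕ.+ k)) (W-lo (d ℕ.+ k))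
      (subst (λ c → P (d ℕ.+ k) + 1ℤ ≤ᶻ c * (pw d * (W k + + 2) - e)) (sym (pw-C-+ d k))
        (product-upper {scaled x (k ℕ.+ s)} {scaled y (k ℕ.+ s)}
                       {scaled x (d ℕ.+ k ℕ.+ s)} {scaled y (d ℕ.+ k ℕ.+ s)}
                       {pw d} {pw (C k)} {W k} {e}
          (pw-pos d) (scaled≥0 x x≥0 (k ℕ.+ s)) (scaled≥0 y y≥0 (d ℕ.+ k ℕ.+ s))
          (lo x d k) (reassoc x x-hi) (reassoc y y-hi)
          (subst (scaled x (d ℕ.+ k ℕ.+ s) + scaled y (d ℕ.+ k ℕ.+ s) ≤ᶻ_)
                 (trans (sym (pw-+ (d ℕ.+ k ℕ.+ s) s)) (pw-C-+ d k))
                 (x+y-bound (d ℕ.+ k ℕ.+ s)))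
          (W-hi k)))
      where
      reassoc : ∀ z → scaled z (d ℕ.+ (k ℕ.+ s)) + e ≤ᶻ pw d * (scaled z (k ℕ.+ s) + 1ℤ) →
                scaled z (d ℕ.+ k ℕ.+ s) + e ≤ᶻ pw d * (scaled z (k ℕ.+ s) + 1ℤ)
      reassoc z = subst (λ j → scaled z j + e ≤ᶻ pw d * (scaled z (k ℕ.+ s) + 1ℤ))
                        (sym (ℕₚ.+-assoc d k s))

    W-hi₂ : ∀ d k → W (d ℕ.+ k) + 1ℤ ≤ᶻ pw d * (W k + + 2) - 1ℤ
    W-hi₂ d k = W-upper d k 1ℤ (scaled-hi x d (k ℕ.+ s)) (scaled-hi y d (k ℕ.+ s))

    -- The margin of `gap` keeps the limit strictly below `W k + + 2`. The distance is a successor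
    -- so that `q≤W` can set it against `growth` started one place later.
    W-gap : ∀ k → ∃ λ d → W (suc d ℕ.+ k) + + 11 ≤ᶻ pw (suc d) * (W k + + 2)
    W-gap k = d , by-slack
      (slack (W-upper (suc d) k (+ 10)
        (proj₂ (gap x (k ℕ.+ s)) (suc d) (ℕₚ.m≤n⇒m≤1+n (ℕₚ.m≤m⊔n d₁ d₂)))
        (proj₂ (gap y (k ℕ.+ s)) (suc d) (ℕₚ.m≤n⇒m≤1+n (ℕₚ.m≤n⊔m d₁ d₂)))))
      (eq (pw (suc d) * (W k + + 2)) (W (suc d ℕ.+ k)))
      where
      d₁ d₂ d : ℕ
      d₁ = proj₁ (gap x (k ℕ.+ s))
      d₂ = proj₁ (gap y (k ℕ.+ s))
      d = d₁ ℕ.⊔ d₂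
      eq : ∀ v w → v - (w + + 11) ≡ (v - + 10) - (w + 1ℤ)
      eq = solve-∀

    W-coherent : Coherent W
    W-coherent = Coherent-within 2 W-mono λ d k →
      by-slack (0≤+ (slack (W-hi₂ d k)) (0≤pos 2)) (eq (pw d * (W k + + 2)) (W (d ℕ.+ k)))
      where
      eq : ∀ v w → v - w ≡ ((v - 1ℤ) - (w + 1ℤ)) + + 2
      eq = solve-∀

    -- Digits and truncations of a product are prescribed through some terminating decimal t of that
    -- value; this ties every such t to the integer `W k`.
    W-unique : ∀ t k → t ≙ (trunc x (k ℕ.+ s) ℚ.* trunc y (k ℕ.+ s)) → scaled t k ≡ W k
    W-unique t k t≙ = ℤₚ.≤-antisym
      (+1≤+1 (squeeze (C k) (subst (pw (C k) * scaled t k ≤ᶻ_) exact (scaled-lo t (C k) k)) (W-hi k)))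
      (+1≤+1 (squeeze (C k) (W-lo k)
        (subst (λ p → p + 1ℤ ≤ᶻ pw (C k) * (scaled t k + 1ℤ)) exact (scaled-hi t (C k) k))))
      where
      K : ℕ
      K = k ℕ.+ s
      index : ∀ k s → k ℕ.+ s ℕ.+ s ℕ.+ k ≡ k ℕ.+ s ℕ.+ (k ℕ.+ s)
      index = ℕ-Solver.solve-∀
      exact : scaled t (C k ℕ.+ k) ≡ P k
      exact = trans (cong (scaled t) (index k s))
        (trans (≙-scaled t (P k) (K ℕ.+ K) (≙-resp {t} (trunc-* x y K) t≙) 0) (pw0-* _))

    -- A digit 9 at every place k > m leaves for W (k + 1) only 10 W k + 9 and
    -- 10 W k + 19; the latter would put the limit at the excluded value W k + 2.
    module Nines (m : ℕ) (nine : ∀ k → m ℕ.≤ k → ∃ λ q → W (suc k) ≡ + 10 * q + + 9) where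

      q≥W : ∀ k q → W (suc k) ≡ + 10 * q + + 9 → W k ≤ᶻ q
      q≥W k q eq = +1≤+1 (squeeze 1
        (subst (pw 1 * W k ≤ᶻ_) eq (W-mono 1 k))
        (ℤₚ.≤-reflexive (trans (e q) (cong (_* (q + 1ℤ)) (sym pw1)))))
        where
        e : ∀ q → + 10 * q + + 9 + 1ℤ ≡ + 10 * (q + 1ℤ)
        e = solve-∀

      -- By `q≥W`, one more place multiplies W + 1 by at least ten.
      growth : ∀ k → m ℕ.≤ k → ∀ d → pw d * (W k + 1ℤ) ≤ᶻ W (d ℕ.+ k) + 1ℤ
      growth k m≤k zero    = ℤₚ.≤-reflexive (pw0-* _)
      growth k m≤k (suc d) = by-slack
        (0≤+ (0≤* (0≤pos 10) (slack (growth k m≤k d))) (0≤* (0≤pos 10) (slack (q≥W (d ℕ.+ k) q eq))))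
        (trans (cong₂ (λ w p → w + 1ℤ - p * (W k + 1ℤ)) eq (pw-suc d))
               (e q (pw d) (W k) (W (d ℕ.+ k))))
        where
        q : ℤ
        q = proj₁ (nine (d ℕ.+ k) (ℕₚ.≤-trans m≤k (ℕₚ.m≤n+m k d)))
        eq : W (suc (d ℕ.+ k)) ≡ + 10 * q + + 9
        eq = proj₂ (nine (d ℕ.+ k) (ℕₚ.≤-trans m≤k (ℕₚ.m≤n+m k d)))
        e : ∀ q p w v → + 10 * q + + 9 + 1ℤ - (+ 10 * p) * (w + 1ℤ)
                      ≡ + 10 * ((v + 1ℤ) - p * (w + 1ℤ)) + + 10 * (q - v)
        e = solve-∀

      -- If q ≥ W k + 1, then W (k + 1) + 1 ≥ 10 (W k + 2), and `growth` carries this to a place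
      -- where `W-gap` forbids it.
      q≤W : ∀ k → m ℕ.≤ k → ∀ q → W (suc k) ≡ + 10 * q + + 9 → q ≤ᶻ W k
      q≤W k m≤k q eq = ℤₚ.≮⇒≥ λ W<q → impossible {W (suc d ℕ.+ k)} (by-slack
        (0≤+ (0≤+ (slack (proj₂ (W-gap k)))
                  (slack (subst (λ j → pw d * (W (suc k) + 1ℤ) ≤ᶻ W j + 1ℤ) (ℕₚ.+-suc d k)
                                (growth (suc k) (ℕₚ.m≤n⇒m≤1+n m≤k) d))))
             (0≤+ (0≤* (0≤* (0≤pos 10) (0≤pw d)) (slack (<⇒+1≤ W<q))) (0≤pos 9)))
        (trans (e (W (suc d ℕ.+ k)) (pw d) (W k) q)
          (cong₂ (λ v p → (p * (W k + + 2) - (W (suc d ℕ.+ k) + + 11))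
                        + ((W (suc d ℕ.+ k) + 1ℤ) - pw d * (v + 1ℤ))
                        + ((+ 10 * pw d) * (q - (W k + 1ℤ)) + + 9))
                 (sym eq) (sym (pw-suc d)))))
        where
        d : ℕ
        d = proj₁ (W-gap k)
        e : ∀ w p v q → w - (w + 1ℤ) ≡
            ((+ 10 * p) * (v + + 2) - (w + + 11)) + ((w + 1ℤ) - p * (+ 10 * q + + 9 + 1ℤ))
            + ((+ 10 * p) * (q - (v + 1ℤ)) + + 9)
        e = solve-∀

      step : ∀ k → m ℕ.≤ k → W (suc k) ≡ + 10 * W k + + 9
      step k m≤k = let q , eq = nine k m≤k in
        trans eq (cong (λ q → + 10 * q + + 9) (ℤₚ.≤-antisym (q≤W k m≤k q eq) (q≥W k q eq)))

    private
      X Y : ℕ → ℤ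
      X = scaled x
      Y = scaled y
      r : ℤ
      r = pw s

      -- The distance s is fixed, so the drift bound D 10^s is a constant.
      shift : ∀ z → O 0 (λ k → scaled z (k ℕ.+ s) - r * scaled z k)
      shift z = let coherent D p = scaled-coherent z in
        bounded (D ℕ.* 10 ℕ.^ s) λ k → subst₂ ℕ._≤_
          (cong (λ j → ∣ scaled z j - r * scaled z k ∣) (ℕₚ.+-comm s k))
          (sym (ℕₚ.*-identityʳ (D ℕ.* 10 ℕ.^ s))) (p s k)

      shift-O₁ : ∀ z → O 1 (λ k → scaled z (k ℕ.+ s))
      shift-O₁ z = O-cong (λ k → eq (scaled z (k ℕ.+ s)) (r * scaled z k))
        (O-+ (O-suc (shift z)) (O-* (O-const r) (scaled-O₁ z)))
        where
        eq : ∀ a b → (a - b) + b ≡ a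
        eq = solve-∀

      pw-C : ∀ k → pw (C k) ≡ (r * r) * pw k
      pw-C k = trans (pw-+ (k ℕ.+ s) s) (trans (cong (_* r) (pw-+ k s)) (eq (pw k) r))
        where
        eq : ∀ p r → (p * r) * r ≡ (r * r) * p
        eq = solve-∀

      remainder : O 1 (λ k → P k - pw (C k) * W k)
      remainder = O-within (λ k → slack (W-lo k))
        (λ k → by-slack (0≤+ (slack (W-hi k)) (0≤pos 1))
          (trans (cong (_- (P k - pw (C k) * W k)) (sym (pw-C k))) (eq (P k) (pw (C k)) (W k))))
        (O-* (O-const (r * r)) O-pw)
        where
        eq : ∀ p c w → c - (p - c * w) ≡ (c * (w + 1ℤ) - (p + 1ℤ)) + 1ℤ
        eq = solve-∀

    -- With r = 10^s, replacing X (k + s) by r X k and Y (k + s) by r Y k one at a time costs a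
    -- bounded error times a factor of order 10^k; the floor leaves a remainder below r² 10^k. All
    -- this estimates r² times the claim, and the constant r² is cancelled.
    product-near : O 1 (λ k → pw k * W k - X k * Y k)
    product-near = O-cancel 0 {1} {λ k → pw k * W k - X k * Y k} (λ _ → r * r) r²-large
      (O-cong combine (O-- (O-+ (O-* (shift x) (shift-O₁ y))
                                (O-* (O-* (O-const r) (scaled-O₁ x)) (shift y)))
                           remainder))
      where
      r²-large : ∀ k → (10 ℕ.^ k) ℕ.^ 0 ℕ.≤ ∣ r * r ∣
      r²-large k = subst (1 ℕ.≤_) (sym (trans (∣pw*i∣ s r) (cong (10 ℕ.^ s ℕ.*_) (∣pw∣ s))))
        (ℕₚ.*-mono-≤ (10^>0 s) (10^>0 s))
      eq : ∀ x' y' x y r p w → (x' - r * x) * y' + (r * x) * (y' - r * y) - (x' * y' - ((r * r) * p) * w)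
                             ≡ (r * r) * (p * w - x * y)
      eq = solve-∀
      combine : ∀ k → ((X (k ℕ.+ s) - r * X k) * Y (k ℕ.+ s) + (r * X k) * (Y (k ℕ.+ s) - r * Y k))
                      - (P k - pw (C k) * W k)
                    ≡ (r * r) * (pw k * W k - X k * Y k)
      combine k = trans
        (cong (λ c → ((X (k ℕ.+ s) - r * X k) * Y (k ℕ.+ s) + (r * X k) * (Y (k ℕ.+ s) - r * Y k))
                     - (P k - c * W k)) (pw-C k))
        (eq (X (k ℕ.+ s)) (Y (k ℕ.+ s)) (X k) (Y k) r (pw k) (W k))

  -- Decimals approximating a given integer sequence

  floorSequence-coherent : ∀ {Z : ℕ → ℤ} → (∀ k → + 10 * Z k ≤ᶻ Z (suc k)) →
                           (∀ k → Z (suc k) ≤ᶻ + 10 * Z k + + 9) → Coherent Z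
  floorSequence-coherent {Z} lo hi = Coherent-within 1 below λ d k →
    ℤₚ.≤-trans (ℤₚ.i≤i+j _ 1ℤ) (above d k)
    where
    below : ∀ d k → pw d * Z k ≤ᶻ Z (d ℕ.+ k)
    below zero    k = ℤₚ.≤-reflexive (pw0-* _)
    below (suc d) k = ℤₚ.≤-trans (by-slack (0≤* (0≤pos 10) (slack (below d k)))
        (trans (cong (λ p → + 10 * Z (d ℕ.+ k) - p * Z k) (pw-suc d)) (eq (Z (d ℕ.+ k)) (pw d) (Z k))))
      (lo (d ℕ.+ k))
      where
      eq : ∀ z p w → + 10 * z - (+ 10 * p) * w ≡ + 10 * (z - p * w)
      eq = solve-∀
    above : ∀ d k → Z (d ℕ.+ k) + 1ℤ ≤ᶻ pw d * (Z k + 1ℤ)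
    above zero    k = ℤₚ.≤-reflexive (sym (pw0-* _))
    above (suc d) k = by-slack
      (0≤+ (slack (hi (d ℕ.+ k))) (0≤* (0≤pos 10) (slack (above d k))))
      (trans (cong (λ p → p * (Z k + 1ℤ) - (Z (suc (d ℕ.+ k)) + 1ℤ)) (pw-suc d))
             (eq (pw d) (Z k) (Z (suc (d ℕ.+ k))) (Z (d ℕ.+ k))))
      where
      eq : ∀ p w z' z → (+ 10 * p) * (w + 1ℤ) - (z' + 1ℤ)
                      ≡ (+ 10 * z + + 9 - z') + + 10 * (p * (w + 1ℤ) - (z + 1ℤ))
      eq = solve-∀

  O-≡ : ∀ {n} {f g : ℕ → ℤ} → (∀ k → f k ≡ g k) → O n (λ k → f k - g k)
  O-≡ {g = g} f≡g = O-cong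
    (λ k → sym (trans (cong (_- g k) (f≡g k)) (ℤₚ.+-inverseʳ (g k)))) O-zero

  module _ (em : ExcludedMiddle 0ℓ) where

    -- A sequence ending in nines is not the sequence of truncations of any element of `ℝ`; in that
    -- case the carried terminating decimal takes its place, one unit off.
    complete : ∀ (Z : ℕ → ℤ) → (∀ k → + 10 * Z k ≤ᶻ Z (suc k)) →
               (∀ k → Z (suc k) ≤ᶻ + 10 * Z k + + 9) →
               ∃ λ x → O 0 (λ k → scaled x k - Z k)
    complete Z lo hi with em {∃ λ m → ∀ k → m ℕ.< k → Z k ≡ + 10 * Z (pred k) + + 9}
    ... | yes (m , nine) =
      let t , t≙ , _ = terminal-≙ (Z m + 1ℤ) m in
      t , carry-limit (floorSequence-coherent lo hi) t m (λ k m≤k → nine (suc k) (ℕ.s≤s m≤k)) t≙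
    ... | no ¬nine =
      let x , x≡Z = fromScaled Z lo hi short in x , O-≡ x≡Z
      where
      short : ∀ n → ∃ λ k → n ℕ.≤ k × Z (suc k) + 1ℤ ≤ᶻ + 10 * Z k + + 9
      short n with infinitelyOften em ¬nine n
      ... | suc k , ℕ.s≤s n≤k , ne = k , n≤k , ≤∧≢⇒+1≤ (hi k) ne

    -- Excluded middle decides P during the search downwards: `_fits_`, to which it is applied,
    -- quantifies over all truncations.
    lastTrue : ∀ {P : ℕ → Set} → P 0 → ∀ n → ¬ P n → ∃ λ m → P m × ¬ P (suc m)
    lastTrue         p₀ zero    ¬p = ⊥-elim (¬p p₀)
    lastTrue {P = P} p₀ (suc n) ¬p with em {P n}
    ... | yes p = n , p , ¬p
    ... | no ¬p′ = lastTrue {P = P} p₀ n ¬p′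

  -- Reciprocals

  scaled-cross : ∀ x j k → scaled x j * pw k ≤ᶻ (scaled x k + 1ℤ) * pw j
  scaled-cross x j k with ℕₚ.≤-total k j
  ... | inj₁ k≤j = subst (λ j → scaled x j * pw k ≤ᶻ (scaled x k + 1ℤ) * pw j) (ℕₚ.m∸n+n≡m k≤j)
    (by-slack (0≤* (0≤pw k) (0≤+ (slack (scaled-hi x d k)) (0≤pos 1)))
      (trans (cong (λ p → (scaled x k + 1ℤ) * p - scaled x (d ℕ.+ k) * pw k) (pw-+ d k))
             (eq (scaled x k) (pw d) (pw k) (scaled x (d ℕ.+ k)))))
    where
    d : ℕ
    d = j ℕ.∸ k
    eq : ∀ s p q t → (s + 1ℤ) * (p * q) - t * q ≡ q * ((p * (s + 1ℤ) - (t + 1ℤ)) + 1ℤ)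
    eq = solve-∀
  ... | inj₂ j≤k = subst (λ k → scaled x j * pw k ≤ᶻ (scaled x k + 1ℤ) * pw j) (ℕₚ.m∸n+n≡m j≤k)
    (by-slack (0≤* (0≤pw j) (0≤+ (slack (scaled-lo x d j)) (0≤pos 1)))
      (trans (cong (λ p → (scaled x (d ℕ.+ j) + 1ℤ) * pw j - scaled x j * p) (pw-+ d j))
             (eq (scaled x (d ℕ.+ j)) (pw d) (pw j) (scaled x j))))
    where
    d : ℕ
    d = k ℕ.∸ j
    eq : ∀ t p q s → (t + 1ℤ) * q - s * (p * q) ≡ q * ((t - p * s) + 1ℤ)
    eq = solve-∀

  -- Z k is the greatest integer with Z k · x ≤ 10^k; comparing with every
  -- truncation of x keeps this a statement about integers.
  module Reciprocal (em : ExcludedMiddle 0ℓ) (x : ℝ) (x≥0 : NonNegative x)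
    (s : ℕ) (x-positive : 1ℤ ≤ᶻ scaled x s) where

    X : ℕ → ℤ
    X = scaled x

    record _fits_ (n : ℤ) (k : ℕ) : Set where
      constructor fitting
      field at : ∀ j → n * X j ≤ᶻ pw k * pw j

    open _fits_

    fits-antitone : ∀ {m n} k → m ≤ᶻ n → n fits k → m fits k
    fits-antitone {m} {n} k m≤n n-fits = fitting λ j → by-slack
      (0≤+ (slack (at n-fits j)) (0≤* (slack m≤n) (scaled≥0 x x≥0 j)))
      (eq (pw k * pw j) m n (X j))
      where
      eq : ∀ p m n x → p - m * x ≡ (p - n * x) + (n - m) * x
      eq = solve-∀

    fits-suc : ∀ {n} k → n fits k → (+ 10 * n) fits suc k
    fits-suc {n} k n-fits = fitting λ j → by-slack (0≤* (0≤pos 10) (slack (at n-fits j)))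
      (trans (cong (λ p → p * pw j - (+ 10 * n) * X j) (pw-suc k)) (eq (pw k) (pw j) n (X j)))
      where
      eq : ∀ p q n x → (+ 10 * p) * q - (+ 10 * n) * x ≡ + 10 * (p * q - n * x)
      eq = solve-∀

    fits-pred : ∀ {n} k → (+ 10 * n) fits suc k → n fits k
    fits-pred {n} k n-fits = fitting λ j → cancel-≤ 1 (by-slack (slack (at n-fits j))
      (trans (cong (λ t → t * (pw k * pw j) - t * (n * X j)) pw1)
        (trans (eq (pw k) (pw j) n (X j))
               (cong (λ p → p * pw j - (+ 10 * n) * X j) (sym (pw-suc k))))))
      where
      eq : ∀ p q n x → + 10 * (p * q) - + 10 * (n * x) ≡ (+ 10 * p) * q - (+ 10 * n) * x
      eq = solve-∀

    fits-bound : ∀ {n} k → 0ℤ ≤ᶻ n → n fits k → n ≤ᶻ pw k * pw s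
    fits-bound {n} k 0≤n n-fits = by-slack
      (0≤+ (slack (at n-fits s)) (0≤* 0≤n (slack x-positive))) (eq (pw k * pw s) n (X s))
      where
      eq : ∀ p n x → p - n ≡ (p - n * x) + n * (x - 1ℤ)
      eq = solve-∀

    greatest : ∀ k → ∃ λ n → (+ n) fits k × ¬ (+ suc n) fits k
    greatest k = lastTrue em {λ n → (+ n) fits k}
      (fitting λ j → subst (_≤ᶻ pw k * pw j) (sym (ℤₚ.*-zeroˡ (X j))) (0≤* (0≤pw k) (0≤pw j)))
      -- One more than `fits-bound` allows, hence a point where fitting fails.
      (suc (10 ℕ.^ (k ℕ.+ s)))
      λ B-fits → impossible {pw k * pw s} (subst (_≤ᶻ pw k * pw s)
        (trans (ℤₚ.+-comm 1ℤ (+ (10 ℕ.^ (k ℕ.+ s))))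
               (cong (_+ 1ℤ) (trans (+10^≡pw (k ℕ.+ s)) (pw-+ k s))))
        (fits-bound k (0≤pos _) B-fits))

    Z : ℕ → ℤ
    Z k = + proj₁ (greatest k)

    Z-fits : ∀ k → Z k fits k
    Z-fits k = proj₁ (proj₂ (greatest k))

    Z+1-overshoots : ∀ k → ¬ (Z k + 1ℤ) fits k
    Z+1-overshoots k n-fits = proj₂ (proj₂ (greatest k)) (subst (_fits k) (ℤₚ.+-comm (Z k) 1ℤ) n-fits)

    Z-lo : ∀ k → + 10 * Z k ≤ᶻ Z (suc k)
    Z-lo k = ℤₚ.≮⇒≥ λ lt → Z+1-overshoots (suc k)
      (fits-antitone (suc k) (<⇒+1≤ lt) (fits-suc k (Z-fits k)))

    Z-hi : ∀ k → Z (suc k) ≤ᶻ + 10 * Z k + + 9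
    Z-hi k = ℤₚ.≮⇒≥ λ lt → Z+1-overshoots k (fits-pred k
      (fits-antitone (suc k) (by-slack (slack (<⇒+1≤ lt)) (eq (Z k) (Z (suc k)))) (Z-fits (suc k))))
      where
      eq : ∀ z w → w - + 10 * (z + 1ℤ) ≡ w - (+ 10 * z + + 9 + 1ℤ)
      eq = solve-∀

    -- Every x_j is at most (X k + 1) / 10^k by `scaled-cross`; if the product were smaller than
    -- 10^{2k}, then Z k + 1 would still fit.
    Z-tight : ∀ k → pw k * pw k ≤ᶻ (Z k + 1ℤ) * (X k + 1ℤ)
    Z-tight k = ℤₚ.≮⇒≥ λ lt → Z+1-overshoots k (fitting λ j → cancel-≤ k (by-slack
      (0≤+ (0≤+ (0≤* (0≤pw j) (slack (<⇒+1≤ lt))) (0≤pw j))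
           (0≤* {Z k + 1ℤ} (0≤+ {Z k} (0≤pos _) (0≤pos 1)) (slack (scaled-cross x j k))))
      (eq (pw k) (pw j) (Z k) (X j) (X k))))
      where
      eq : ∀ p q z xj xk → p * (p * q) - p * ((z + 1ℤ) * xj)
         ≡ (q * (p * p - ((z + 1ℤ) * (xk + 1ℤ) + 1ℤ)) + q) + (z + 1ℤ) * ((xk + 1ℤ) * q - xj * p)
      eq = solve-∀

    Z-O₁ : O 1 Z
    Z-O₁ = O-within (λ k → 0≤pos _) (λ k → fits-bound k (0≤pos _) (Z-fits k))
      (O-* O-pw (O-const (pw s)))

    X*Z-near : O 1 (λ k → pw k * pw k - X k * Z k)
    X*Z-near = O-within
      (λ k → slack (subst (_≤ᶻ pw k * pw k) (ℤₚ.*-comm (Z k) (X k)) (at (Z-fits k) k)))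
      (λ k → by-slack (slack (Z-tight k)) (eq (pw k * pw k) (X k) (Z k)))
      (O-+ (O-+ Z-O₁ (scaled-O₁ x)) (O-suc (O-const 1ℤ)))
      where
      eq : ∀ p x z → (z + x + 1ℤ) - (p - x * z) ≡ (z + 1ℤ) * (x + 1ℤ) - p
      eq = solve-∀

    reciprocal : ∃ λ y → O 1 (λ k → X k * scaled y k - pw k * pw k)
    reciprocal = let y , y-near = complete em Z Z-lo Z-hi in
      y , O-cong (λ k → eq (X k) (scaled y k) (Z k) (pw k * pw k))
                 (O-- (O-* (scaled-O₁ x) y-near) X*Z-near)
      where
      eq : ∀ x y z p → x * (y - z) - (p - x * z) ≡ x * y - p
      eq = solve-∀

  -- Field laws

  near-unique : ∀ {x y} {f g : ℕ → ℤ} → O 0 (λ k → scaled x k - f k) →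
                O 0 (λ k → scaled y k - g k) → O 0 (λ k → f k - g k) → x ≈ y
  near-unique {x} {y} {f} {g} p q r = near⇒≈ x y
    (O-cong (λ k → eq (scaled x k) (scaled y k) (f k) (g k)) (O-+ (O-- p q) r))
    where
    eq : ∀ x y f g → ((x - f) - (y - g)) + (f - g) ≡ x - y
    eq = solve-∀

  -- Products are known only after multiplication by 10^k, up to O(10^k); cancelling `pw k` restores
  -- the bounded error that `near⇒≈` asks for.
  near-unique₁ : ∀ {x y} {f g : ℕ → ℤ} → O 1 (λ k → pw k * scaled x k - f k) →
                 O 1 (λ k → pw k * scaled y k - g k) → O 1 (λ k → f k - g k) → x ≈ y
  near-unique₁ {x} {y} {f} {g} p q r = near⇒≈ x y (O-cancel-pw
    (O-cong (λ k → eq (pw k) (scaled x k) (scaled y k) (f k) (g k)) (O-+ (O-- p q) r)))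
    where
    eq : ∀ p x y f g → ((p * x - f) - (p * y - g)) + (f - g) ≡ p * (x - y)
    eq = solve-∀

  ≈-isEquivalence : IsEquivalence _≈_
  ≈-isEquivalence = record
    { refl  = digitwise λ _ → refl
    ; sym   = λ eq → digitwise λ k → sym (θ-≡ eq k)
    ; trans = λ p q → digitwise λ k → trans (θ-≡ p k) (θ-≡ q k)
    }

  ≈-setoid : Setoid 0ℓ 0ℓ
  ≈-setoid = record { isEquivalence = ≈-isEquivalence }

  module Field (em : ExcludedMiddle 0ℓ) where

    open Arithmetic em public using ()
      renaming (_+_ to infixl 6 _⊕_; _*_ to infixl 7 _⊗_; -_ to infix 8 ⊝_)
    open Arithmetic em using
      (IsProduct; IsNonNegProduct; nonNeg-nonNeg; neg-neg; nonNeg-neg; neg-nonNeg; case₁; case₂;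
       +-isSum; -‿isNegation; *-isProduct; -‿nonNegative)

    -- Error estimates for the operations

    ⊕-near : ∀ x y → O 0 (λ k → scaled (x ⊕ y) k - (scaled x k + scaled y k))
    ⊕-near x y = sum-near (+-isSum x y)

    ⊝-near : ∀ x → O 0 (λ k → scaled (⊝ x) k + scaled x k)
    ⊝-near x = negation-near (-‿isNegation x)

    scaled-≤10^ : ∀ z s → z ≤ 10^ s → ∀ k → scaled z k ≤ᶻ pw k * pw s
    scaled-≤10^ z s (inj₁ (zero , _ , z₀<)) k = by-slack
      (0≤+ (0≤+ (slack (whole-hi z k)) (0≤pos 1))
           (0≤* (0≤pw k) (slack (<⇒+1≤ (subst (whole z <ᶻ_) (+10^≡pw s) z₀<)))))
      (eq (pw k) (pw s) (whole z) (scaled z k))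
      where
      eq : ∀ p q w z → p * q - z ≡ ((p * (w + 1ℤ) - (z + 1ℤ)) + 1ℤ) + p * (q - (w + 1ℤ))
      eq = solve-∀
    -- All digits of 10^s after the point are 0, so no digit of z is smaller there.
    scaled-≤10^ z s (inj₁ (suc j , _ , zⱼ<0)) k = ⊥-elim (ℤₚ.<⇒≱ zⱼ<0 (θ≥0 z j))
    scaled-≤10^ z s (inj₂ z≈) k = ℤₚ.≤-reflexive (trans (scaled-cong z≈ k)
      (trans (scaled-fromℤ (+ (10 ℕ.^ s)) k) (cong (pw k *_) (+10^≡pw s))))

    -- The prescription bounds `x ⊕ y`, which is only within c units of X + Y. An excess of one unit
    -- at place k would grow to 10^c > c after c places, contradicting that closeness.
    sum-≤10^ : ∀ x y s → x ⊕ y ≤ 10^ s → ∀ k → scaled x k + scaled y k ≤ᶻ pw k * pw s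
    sum-≤10^ x y s x+y≤ k with ⊕-near x y
    ... | bounded C p = ℤₚ.≮⇒≥ λ lt → impossible {+ c} (ℤₚ.≤-trans
        (by-slack
          (0≤+ (0≤+ (slack (scaled-lo x c k)) (slack (scaled-lo y c k)))
               (0≤+ (0≤+ (slack (scaled-≤10^ (x ⊕ y) s x+y≤ (c ℕ.+ k)))
                         (0≤* (0≤pw c) (slack (<⇒+1≤ lt))))
                    (slack (n<pw c))))
          (trans (eq (scaled x (c ℕ.+ k)) (scaled y (c ℕ.+ k)) (scaled (x ⊕ y) (c ℕ.+ k))
                     (scaled x k) (scaled y k) (pw c) (pw k) (pw s) (+ c))
                 (cong (λ q → ((scaled x (c ℕ.+ k) - pw c * scaled x k)
                               + (scaled y (c ℕ.+ k) - pw c * scaled y k))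
                              + (((q * pw s - scaled (x ⊕ y) (c ℕ.+ k))
                                 + pw c * ((scaled x k + scaled y k) - (pw k * pw s + 1ℤ)))
                                 + (pw c - (+ c + 1ℤ))))
                       (sym (pw-+ c k)))))
        (∣i∣≤n⇒i≤n {scaled x (c ℕ.+ k) + scaled y (c ℕ.+ k) - scaled (x ⊕ y) (c ℕ.+ k)} abs))
      where
      c : ℕ
      c = C ℕ.* 1
      flip : ∀ z w → - (z - w) ≡ w - z
      flip = solve-∀
      abs : ∣ scaled x (c ℕ.+ k) + scaled y (c ℕ.+ k) - scaled (x ⊕ y) (c ℕ.+ k) ∣ ℕ.≤ c
      abs = subst (ℕ._≤ c)
        (trans (sym (ℤₚ.∣-i∣≡∣i∣ (scaled (x ⊕ y) (c ℕ.+ k) - (scaled x (c ℕ.+ k) + scaled y (c ℕ.+ k)))))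
          (cong ∣_∣ (flip (scaled (x ⊕ y) (c ℕ.+ k)) (scaled x (c ℕ.+ k) + scaled y (c ℕ.+ k)))))
        (p (c ℕ.+ k))
      eq : ∀ x' y' z' x y q p r c → (x' + y' - z') - (c + 1ℤ)
         ≡ ((x' - q * x) + (y' - q * y))
           + ((((q * p) * r - z') + q * ((x + y) - (p * r + 1ℤ))) + (q - (c + 1ℤ)))
      eq = solve-∀

    nonNegProduct-near : ∀ {x y z} → NonNegative x → NonNegative y → IsNonNegProduct x y z →
                         O 1 (λ k → pw k * scaled z k - scaled x k * scaled y k)
    nonNegProduct-near {x} {y} {z} x≥0 y≥0 = λ where
        (case₁ s x+y≤ m nine (q , (t , t≙ , t≃q) , z≙)) →
          let open Product x y x≥0 y≥0 s (sum-≤10^ x y s x+y≤) in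
          combine W product-near (carry-limit W-coherent z m
            -- The decimal t truncates the product taken at place k + 1, so `scaled t k` is not
            -- known in advance to be `W k`; `Nines.step` identifies them.
            (Nines.step m λ k m≤k → let t , t≙ , digit = nine (suc k) (ℕ.s≤s m≤k) in
              scaled t k , trans (sym (W-unique t (suc k) t≙))
                                 (cong (λ a → + 10 * scaled t k + a) digit))
            (≙-resp {z} (ℚₚ.≃-trans
              (ℚₚ.+-congˡ (10⁻ m) (ℚₚ.≃-trans (ℚₚ.≃-sym t≃q)
                (ℚₚ.≃-trans (trunc-scaled t m) (ℚₚ.≃-reflexive (cong (_/10^ m) (W-unique t m t≙))))))
              (/10^-+ (W m) 1ℤ m)) z≙))
        (case₂ s x+y≤ κ inc _ truncs) →
          let open Product x y x≥0 y≥0 s (sum-≤10^ x y s x+y≤) in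
          combine W product-near (truncation-limit W-coherent z κ inc λ i →
            let t , t≙ , t≃z = truncs i in
            t , W-unique t (κ i) t≙ , trunc-injective t z (pred (κ i)) t≃z)
      where
      eq : ∀ p z w v → p * (z - w) + (p * w - v) ≡ p * z - v
      eq = solve-∀
      combine : ∀ (W : ℕ → ℤ) → O 1 (λ k → pw k * W k - scaled x k * scaled y k) →
                O 0 (λ k → scaled z k - W k) →
                O 1 (λ k → pw k * scaled z k - scaled x k * scaled y k)
      combine W W-near z-near = O-cong
        (λ k → eq (pw k) (scaled z k) (W k) (scaled x k * scaled y k))
        (O-+ (O-* O-pw z-near) W-near)

    -- Each sign reduction replaces a factor by its negative, at the cost of a bounded error times a
    -- sequence of order 10^k.
    product-near : ∀ {x y z} → IsProduct x y z →
                   O 1 (λ k → pw k * scaled z k - scaled x k * scaled y k)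
    product-near (nonNeg-nonNeg x≥0 y≥0 p) = nonNegProduct-near x≥0 y≥0 p
    product-near {x} {y} {z} (neg-neg _ _ p) = O-cong
      (λ k → eq (pw k * scaled z k) (scaled x k) (scaled y k) (scaled (⊝ x) k) (scaled (⊝ y) k))
      (O-+ (product-near p) (O-- (O-* (scaled-O₁ (⊝ x)) (⊝-near y)) (O-* (scaled-O₁ y) (⊝-near x))))
      where
      eq : ∀ z x y x' y' → (z - x' * y') + (x' * (y' + y) - y * (x' + x)) ≡ z - x * y
      eq = solve-∀
    product-near {x} {y} {z} (nonNeg-neg _ _ w p z≈) = O-cong
      (λ k → trans (eq (pw k) (scaled (⊝ w) k) (scaled w k) (scaled x k) (scaled y k) (scaled (⊝ y) k))
                   (cong (λ z → pw k * z - scaled x k * scaled y k) (sym (scaled-cong z≈ k))))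
      (O-- (O-- (O-* O-pw (⊝-near w)) (product-near p)) (O-* (scaled-O₁ x) (⊝-near y)))
      where
      eq : ∀ p z w x y y' → (p * (z + w) - (p * w - x * y')) - x * (y' + y) ≡ p * z - x * y
      eq = solve-∀
    product-near {x} {y} {z} (neg-nonNeg _ _ w p z≈) = O-cong
      (λ k → trans (eq (pw k) (scaled (⊝ w) k) (scaled w k) (scaled x k) (scaled y k) (scaled (⊝ x) k))
                   (cong (λ z → pw k * z - scaled x k * scaled y k) (sym (scaled-cong z≈ k))))
      (O-- (O-- (O-* O-pw (⊝-near w)) (product-near p)) (O-* (scaled-O₁ y) (⊝-near x)))
      where
      eq : ∀ p z w x y x' → (p * (z + w) - (p * w - x' * y)) - y * (x' + x) ≡ p * z - x * y
      eq = solve-∀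

    ⊗-near : ∀ x y → O 1 (λ k → pw k * scaled (x ⊗ y) k - scaled x k * scaled y k)
    ⊗-near x y = product-near (*-isProduct x y)

    -- Commutative ring laws

    ⊕-cong : ∀ {x x′ y y′} → x ≈ x′ → y ≈ y′ → x ⊕ y ≈ x′ ⊕ y′
    ⊕-cong {x} {x′} {y} {y′} p q = near-unique (⊕-near x y) (⊕-near x′ y′)
      (O-≡ λ k → cong₂ _+_ (scaled-cong p k) (scaled-cong q k))

    ⊕-comm : ∀ x y → x ⊕ y ≈ y ⊕ x
    ⊕-comm x y = near-unique (⊕-near x y) (⊕-near y x)
      (O-≡ λ k → ℤₚ.+-comm (scaled x k) (scaled y k))

    ⊕-assoc : ∀ x y z → (x ⊕ y) ⊕ z ≈ x ⊕ (y ⊕ z)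
    ⊕-assoc x y z = near-unique (⊕-near (x ⊕ y) z) (⊕-near x (y ⊕ z))
      (O-cong (λ k → eq (scaled x k) (scaled y k) (scaled z k) (scaled (x ⊕ y) k) (scaled (y ⊕ z) k))
              (O-- (⊕-near x y) (⊕-near y z)))
      where
      eq : ∀ x y z p q → (p - (x + y)) - (q - (y + z)) ≡ (p + z) - (x + q)
      eq = solve-∀

    scaled-0ℝ : ∀ k → scaled 0ℝ k ≡ 0ℤ
    scaled-0ℝ k = trans (scaled-fromℤ 0ℤ k) (ℤₚ.*-zeroʳ (pw k))

    scaled-1ℝ : ∀ k → scaled 1ℝ k ≡ pw k
    scaled-1ℝ k = trans (scaled-fromℤ 1ℤ k) (ℤₚ.*-identityʳ (pw k))

    ⊕-identityˡ : ∀ x → 0ℝ ⊕ x ≈ x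
    ⊕-identityˡ x = near-unique (⊕-near 0ℝ x) (O-≡ {f = scaled x} λ k → refl)
      (O-≡ λ k → trans (cong (_+ scaled x k) (scaled-0ℝ k)) (ℤₚ.+-identityˡ (scaled x k)))

    ⊝-inverseˡ : ∀ x → ⊝ x ⊕ x ≈ 0ℝ
    ⊝-inverseˡ x = near-unique {g = λ _ → 0ℤ} (⊕-near (⊝ x) x) (O-≡ scaled-0ℝ)
      (O-cong (λ k → sym (ℤₚ.+-identityʳ (scaled (⊝ x) k + scaled x k))) (⊝-near x))

    ⊝-cong : ∀ {x y} → x ≈ y → ⊝ x ≈ ⊝ y
    ⊝-cong {x} {y} p = near⇒≈ (⊝ x) (⊝ y) (O-cong
      (λ k → trans (cong (λ s → (scaled (⊝ x) k + s) - (scaled (⊝ y) k + scaled y k)) (scaled-cong p k))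
                   (eq (scaled (⊝ x) k) (scaled (⊝ y) k) (scaled y k)))
      (O-- (⊝-near x) (⊝-near y)))
      where
      eq : ∀ x y s → (x + s) - (y + s) ≡ x - y
      eq = solve-∀

    ⊗-cong : ∀ {x x′ y y′} → x ≈ x′ → y ≈ y′ → x ⊗ y ≈ x′ ⊗ y′
    ⊗-cong {x} {x′} {y} {y′} p q = near-unique₁ (⊗-near x y) (⊗-near x′ y′)
      (O-≡ λ k → cong₂ _*_ (scaled-cong p k) (scaled-cong q k))

    ⊗-comm : ∀ x y → x ⊗ y ≈ y ⊗ x
    ⊗-comm x y = near-unique₁ (⊗-near x y) (⊗-near y x)
      (O-≡ λ k → ℤₚ.*-comm (scaled x k) (scaled y k))

    -- Multiplying the errors of the inner products by Z and X raises them to order 2, but the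
    -- resulting combination has `pw k` as a factor; cancelling it brings the order back to 1.
    ⊗-assoc : ∀ x y z → (x ⊗ y) ⊗ z ≈ x ⊗ (y ⊗ z)
    ⊗-assoc x y z = near-unique₁ (⊗-near (x ⊗ y) z) (⊗-near x (y ⊗ z)) (O-cancel-pw
      (O-cong (λ k → eq (pw k) (scaled x k) (scaled y k) (scaled z k) (scaled (x ⊗ y) k) (scaled (y ⊗ z) k))
              (O-- (O-* (scaled-O₁ z) (⊗-near x y)) (O-* (scaled-O₁ x) (⊗-near y z)))))
      where
      eq : ∀ p x y z u v → z * (p * u - x * y) - x * (p * v - y * z) ≡ p * (u * z - x * v)
      eq = solve-∀

    ⊗-identityˡ : ∀ x → 1ℝ ⊗ x ≈ x
    ⊗-identityˡ x = near-unique₁ (⊗-near 1ℝ x) (O-≡ {f = λ k → pw k * scaled x k} λ k → refl)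
      (O-≡ λ k → cong (_* scaled x k) (scaled-1ℝ k))

    ⊗-distribˡ-⊕ : ∀ x y z → x ⊗ (y ⊕ z) ≈ x ⊗ y ⊕ x ⊗ z
    ⊗-distribˡ-⊕ x y z = near-unique₁ (⊗-near x (y ⊕ z))
      (O-cong (λ k → eq₁ (pw k) (scaled (x ⊗ y ⊕ x ⊗ z) k) (scaled (x ⊗ y) k) (scaled (x ⊗ z) k)
                         (scaled x k * scaled y k) (scaled x k * scaled z k))
              (O-+ (O-* O-pw (⊕-near (x ⊗ y) (x ⊗ z))) (O-+ (⊗-near x y) (⊗-near x z))))
      (O-cong (λ k → eq₂ (scaled x k) (scaled y k) (scaled z k) (scaled (y ⊕ z) k))
              (O-* (scaled-O₁ x) (⊕-near y z)))
      where
      eq₁ : ∀ p s a b u v → p * (s - (a + b)) + ((p * a - u) + (p * b - v)) ≡ p * s - (u + v)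
      eq₁ = solve-∀
      eq₂ : ∀ x y z s → x * (s - (y + z)) ≡ x * s - (x * y + x * z)
      eq₂ = solve-∀

    -- Inverses of nonzero decimals

    positive-digit : ∀ x → NonNegative x → ¬ (x ≈ 0ℝ) → ∃ λ s → 1ℤ ≤ᶻ scaled x s
    positive-digit x x≥0 x≉0 with em {∃ λ s → 1ℤ ≤ᶻ scaled x s}
    ... | yes p = p
    ... | no ¬p = ⊥-elim (x≉0 (scaled-θ λ k → trans
      (ℤₚ.≤-antisym (ℤₚ.≮⇒≥ λ 0<X → ¬p (k , <⇒+1≤ 0<X)) (scaled≥0 x x≥0 k))
      (sym (scaled-0ℝ k))))

    reciprocal-near : ∀ x → ¬ (x ≈ 0ℝ) →
                      ∃ λ y → O 1 (λ k → scaled x k * scaled y k - pw k * pw k)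
    reciprocal-near x x≉0 with 0ℤ ℤ.≤? whole x
    ... | yes x≥0 = let s , Xs≥1 = positive-digit x x≥0 x≉0 in Reciprocal.reciprocal em x x≥0 s Xs≥1
    ... | no x≱0 =
      let -x≥0 = -‿nonNegative x (ℤₚ.≰⇒> x≱0)
          s , Xs≥1 = positive-digit (⊝ x) -x≥0 -x≉0
          y , y-near = Reciprocal.reciprocal em (⊝ x) -x≥0 s Xs≥1
      -- For negative x the inverse is the negative of the reciprocal of `⊝ x`.
      in ⊝ y , O-cong
        (λ k → eq (scaled x k) (scaled (⊝ x) k) (scaled y k) (scaled (⊝ y) k) (pw k * pw k))
        (O-+ y-near (O-- (O-* (scaled-O₁ x) (⊝-near y)) (O-* (scaled-O₁ y) (⊝-near x))))
      where
      eq : ∀ x x' y y' p → (x' * y - p) + (x * (y' + y) - y * (x' + x)) ≡ x * y' - p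
      eq = solve-∀
      -x≉0 : ¬ (⊝ x ≈ 0ℝ)
      -x≉0 -x≈0 = x≉0 (near⇒≈ x 0ℝ (O-cong
        (λ k → trans (cong (_+ scaled x k) (trans (scaled-cong -x≈0 k) (scaled-0ℝ k)))
                     (trans (ℤₚ.+-comm 0ℤ (scaled x k)) (cong (λ s → scaled x k - s) (sym (scaled-0ℝ k)))))
        (⊝-near x)))

    inverseʳ : ∀ x → ¬ (x ≈ 0ℝ) → ∃ λ y → x ⊗ y ≈ 1ℝ
    inverseʳ x x≉0 = let y , y-near = reciprocal-near x x≉0 in
      y , near-unique₁ (⊗-near x y) (O-≡ λ k → cong (pw k *_) (scaled-1ℝ k)) y-near

mainTheorem1 : (em : ExcludedMiddle 0ℓ) →
    let open Arithmetic em in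
    IsField _≈_ _+_ _*_ -_ 0ℝ 1ℝ
mainTheorem1 em = record
  { isCommutativeRing = record
    { isRing = record
      { +-isAbelianGroup = record
        { isGroup = record
          { isMonoid = record
            { isSemigroup = record
              { isMagma = record { isEquivalence = ≈-isEquivalence ; ∙-cong = ⊕-cong }
              ; assoc   = ⊕-assoc
              }
            ; identity = comm∧idˡ⇒id ⊕-comm ⊕-identityˡ
            }
          ; inverse = comm∧invˡ⇒inv ⊕-comm ⊝-inverseˡ
          ; ⁻¹-cong = ⊝-cong
          }
        ; comm = ⊕-comm
        }
      ; *-cong     = ⊗-cong
      ; *-assoc    = ⊗-assoc
      ; *-identity = comm∧idˡ⇒id ⊗-comm ⊗-identityˡ
      ; distrib    = comm∧distrˡ⇒distr ⊕-cong ⊗-comm ⊗-distribˡ-⊕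
      }
    ; *-comm = ⊗-comm
    }
  ; 0≉1        = λ 0≈1 → 0≢1 (θ-≡ 0≈1 0)
  ; invertible = λ x x≉0 → let y , xy≈1 = inverseʳ x x≉0 in
                 y , IsEquivalence.trans ≈-isEquivalence (⊗-comm y x) xy≈1 , xy≈1
  }
  where
  open DecimalField
  open Algebra.Consequences.Setoid ≈-setoid using (comm∧idˡ⇒id; comm∧invˡ⇒inv; comm∧distrˡ⇒distr)
  open Field em
  0≢1 : ¬ (0ℤ ≡ 1ℤ)
  0≢1 ()
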